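{- Let $\mathcal{M}$ be a deterministic Turing machine with a single binary tape that runs in time $t$. Then there is a Wang B machine $\mathcal{W}_{\mathcal{M}}$ that simulates the computation of $\mathcal{M}$ in time $O(t^3)$.
   Context: **Binary Turing machine.** A (deterministic, single-tape) binary Turing machine is a tuple $M=(Q,\{0,1\},f,q_0,q_{|Q|-1})$, where $Q$ is a finite set of states, $\{0,1\}$ is the tape alphabet, $0$ is the blank symbol, $q_0\in Q$ is the start state and $q_{|Q|-1}\in Q$ is the halt state. The transition function $f: Q\times\{0,1\}\to\{0,1\}\times\{L,R\}\times Q$ is undefined exactly on $\{q_{|Q|-1}\}\times\{0,1\}$. A rule $(q_i,x_1,x_2,D,q_j)$ means: in state $q_i$ reading $x_1$, write $x_2$, move the head one cell in direction $D$, and enter state $q_j$. The tape is bi-infinite and all but finitely many cells contain $0$. **Wang B machine.** A Wang B machine has a single bi-infinite tape over $\{0,1\}$ (blank symbol $0$, finitely many $1$s), one head, and a finite list of instructions $\mathcal{W}=I_0,I_1,\ldots,I_{n-1}$, each of one of the forms: $L$ (move the head one cell left); $R$ (move the head one cell right); $M$ (mark: write $1$ in the current cell); $J(x)$ with $0\le x\le n-1$ (if the current cell contains $1$ then jump to instruction $I_x$, otherwise go on to the next instruction). Execution starts at $I_0$ and one instruction is executed per time step. After executing an $L$, $R$ or $M$ instruction $I_k$, or a jump $I_k=J(x)$ while reading $0$, the machine goes to $I_{k+1}$ if $k<n-1$ and halts if $k=n-1$. **Configuration.** A configuration consists of the control state (or current instruction index), the tape contents and the head position. **Simulation.** $B$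 simulates the computation of $A$ in time $O(g(t))$ if there are an encoding $\varepsilon$ of initial configurations of $A$ as initial configurations of $B$ and a partial decoding $\delta$ from configurations of $B$ to configurations of $A$, both computable by finite-state transducers acting on the tape contents with the head position marked, such that for every initial configuration $c_0$ of $A$ with successive configurations $c_0,c_1,c_2,\ldots$, the run of $B$ started on $\varepsilon(c_0)$ passes, at times $s_0<s_1<s_2<\cdots$, through configurations decoding under $\delta$ to $c_0,c_1,c_2,\ldots$ respectively; $B$ halts if and only if $A$ halts; and if $A$ runs in time $t$ then $B$ runs in time $O(g(t))$, with constant depending only on $A$. **Time convention.** If a machine runs in time $t$, it halts within $t$ steps and uses at most $t$ tape cells (input cells included). -}

module Defs where

open import Data.Bool.Base using (Bool; true; false; if_then_else_)
open import Data.Fin.Base using (Fin; zero; suc; fromℕ; inject₁)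
open import Data.Fin.Relation.Unary.Top using (view; ‵fromℕ; ‵inject₁)
open import Data.Integer.Base using (ℤ; +_; -[1+_])
open import Data.List.Base using (List; []; _∷_; _++_; [_]; map; reverse; length; foldr)
open import Data.Maybe.Base using (Maybe; just; nothing; _>>=_)
import Data.Maybe.Base as Maybe
open import Data.Nat.Base using (ℕ; zero; suc; _+_; _*_; _≤_; _<_)
open import Data.Product.Base using (_×_; _,_; ∃-syntax)
open import Data.Vec.Base using (Vec; lookup)
open import Function.Bundles using (_⇔_)
open import Relation.Binary.PropositionalEquality.Core using (_≡_)

------------------------------------------------------------------------
-- Tapes

-- true is the symbol 1 and false is the blank 0.  A bi-infinite tape with
-- finitely many 1s is given by a finite window of cells containing the head;
-- every cell outside the window is blank.  Both sides are listed starting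
-- from the cell nearest to the head.
--
-- The window never shrinks during a run, so at any time it consists of the
-- input cells and the cells visited since; its width counts the cells used.
-- Windows differing in outer blanks are the same tape, see _≈_ below.

record Tape : Set where
  constructor tape
  field
    leftward  : List Bool
    head      : Bool
    rightward : List Bool

open Tape public

width : Tape → ℕ
width (tape ls _ rs) = length ls + suc (length rs)

data Direction : Set where
  L R : Direction

move : Direction → Tape → Tape
move L (tape []       h rs) = tape [] false (h ∷ rs)
move L (tape (l ∷ ls) h rs) = tape ls l (h ∷ rs)
move R (tape ls h [])       = tape (h ∷ ls) false []
move R (tape ls h (r ∷ rs)) = tape (h ∷ ls) r rs

write : Bool → Tape → Tape
write x (tape ls _ rs) = tape ls x rs

nth : List Bool → ℕ → Bool
nth []       _       = false
nth (b ∷ _)  zero    = b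
nth (_ ∷ bs) (suc i) = nth bs i

-- The contents of the bi-infinite tape, the head being at coordinate 0.

cell : Tape → ℤ → Bool
cell t (+ zero)    = head t
cell t (+ (suc i)) = nth (rightward t) i
cell t -[1+ i ]    = nth (leftward t) i

-- The smallest window of the same tape.

consUnlessBlank : Bool → List Bool → List Bool
consUnlessBlank false [] = []
consUnlessBlank b     bs = b ∷ bs

dropOuterBlanks : List Bool → List Bool
dropOuterBlanks = foldr consUnlessBlank []

minimise : Tape → Tape
minimise (tape ls h rs) = tape (dropOuterBlanks ls) h (dropOuterBlanks rs)

------------------------------------------------------------------------
-- Machines

record Config (n : ℕ) : Set where
  constructor config
  field
    control  : Fin n
    contents : Tape

open Config public

infix 4 _≈_

_≈_ : ∀ {n} → Config n → Config n → Set
c ≈ d = control c ≡ control d × (∀ z → cell (contents c) z ≡ cell (contents d) z)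

-- What Turing machines and Wang B machines have in common.  A configuration
-- without successor is halted.

record Machine : Set where
  field
    controls : ℕ
    start    : Fin controls
    step     : Config controls → Maybe (Config controls)

  Configuration : Set
  Configuration = Config controls

  Initial : Configuration → Set
  Initial c = control c ≡ start

  Halted : Configuration → Set
  Halted c = step c ≡ nothing

  run : ℕ → Configuration → Maybe Configuration
  run zero    c = just c
  run (suc i) c = run i c >>= step

  HaltsFrom : Configuration → Set
  HaltsFrom c = ∃[ i ] ∃[ d ] run i c ≡ just d × Halted d

  -- Halts within t steps and uses at most t cells, input cells included.

  RunsInTime : Configuration → ℕ → Set
  RunsInTime c t =
    ∃[ i ] ∃[ d ] i ≤ t × run i c ≡ just d × Halted d × width (contents d) ≤ t

record TuringMachine : Set where
  field
    last : ℕ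
    f    : Fin (suc last) → Bool → Maybe (Bool × Direction × Fin (suc last))
    f-undefined : ∀ q x → f q x ≡ nothing ⇔ q ≡ fromℕ last

  step : Config (suc last) → Maybe (Config (suc last))
  step (config q t) =
    Maybe.map (λ (x , D , q′) → config q′ (move D (write x t))) (f q (head t))

  turing : Machine
  turing = record { controls = suc last ; start = zero ; step = step }

open TuringMachine public using (turing)

data Instruction (n : ℕ) : Set where
  L R M : Instruction n
  J     : Fin n → Instruction n

record WangB : Set where
  field
    last         : ℕ
    instructions : Vec (Instruction (suc last)) (suc last)

  -- With n instructions, the control is the index of the current instruction,
  -- or n once the machine has run past the last one and halted.

  n : ℕ
  n = suc last

  execute : Instruction n → Fin n → Tape → Config (suc n)
  execute L     k t = config (suc k) (move L t)
  execute R     k t = config (suc k) (move R t)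
  execute M     k t = config (suc k) (write true t)
  execute (J x) k t = config (if head t then inject₁ x else suc k) t

  step : Config (suc n) → Maybe (Config (suc n))
  step (config k t) with view k
  ... | ‵fromℕ     = nothing
  ... | ‵inject₁ j = just (execute (lookup instructions j) j t)

  wangB : Machine
  wangB = record { controls = suc n ; start = zero ; step = step }

open WangB public using (wangB)

------------------------------------------------------------------------
-- Finite-state transducers

-- Deterministic, one-way, with output at the end of the input; rejecting when
-- `final` is undefined.

record Transducer (Γ Δ : Set) : Set where
  field
    states : ℕ
    start  : Fin states
    next   : Fin states → Γ → Fin states × List Δ
    final  : Fin states → Maybe (List Δ)

  transduceFrom : Fin states → List Γ → Maybe (List Δ)
  transduceFrom p []      = final p
  transduceFrom p (a ∷ w) =
    let (p′ , u) = next p a in Maybe.map (u ++_) (transduceFrom p′ w)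

  transduce : List Γ → Maybe (List Δ)
  transduce = transduceFrom start

-- A configuration as a word, read from left to right: the head position is
-- marked, and the mark carries the control.

Letter : ℕ → Set
Letter n = Bool × Maybe (Fin n)

unmarked : ∀ {n} → Bool → Letter n
unmarked b = b , nothing

word : ∀ {n} → Config n → List (Letter n)
word (config q (tape ls h rs)) =
  map unmarked (reverse ls) ++ [ (h , just q) ] ++ map unmarked rs

-- The partial map on configurations computed by a transducer.  It reads the
-- minimal window, so that its value depends on the tape and not on the window
-- representing it; it is undefined where the output is not a configuration.

infix 4 _⟨_⟩↦_

_⟨_⟩↦_ : ∀ {m n} → Transducer (Letter m) (Letter n) → Config m → Config n → Set
T ⟨ c ⟩↦ d =
  Transducer.transduce T (word (config (control c) (minimise (contents c))))
    ≡ just (word d)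

------------------------------------------------------------------------
-- Simulation

module _ (B A : Machine) where

  private
    module A = Machine A
    module B = Machine B

  Decoding : Set
  Decoding = Transducer (Letter B.controls) (Letter A.controls)

  Encoding : Set
  Encoding = Transducer (Letter A.controls) (Letter B.controls)

  Decodes : Decoding → B.Configuration → A.Configuration → Set
  Decodes δ b a = ∃[ a′ ] δ ⟨ b ⟩↦ a′ × a′ ≈ a

  -- The run of B from b₀ follows the run of A from a₀.  If A halts after k
  -- steps, only s 0 < ⋯ < s k are constrained beyond being increasing.

  record Follows (δ : Decoding) (b₀ : B.Configuration) (a₀ : A.Configuration) : Set where
    field
      s            : ℕ → ℕ
      s-increasing : ∀ i → s i < s (suc i)
      passes       : ∀ i a → A.run i a₀ ≡ just a →
                     ∃[ b ] B.run (s i) b₀ ≡ just b × Decodes δ b a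
      halts        : B.HaltsFrom b₀ ⇔ A.HaltsFrom a₀

  record SimulatesInTimeO (g : ℕ → ℕ) : Set where
    field
      ε       : Encoding
      δ       : Decoding
      factor  : ℕ
      encodes : ∀ a₀ → A.Initial a₀ → ∃[ b₀ ]
                  ε ⟨ a₀ ⟩↦ b₀ × B.Initial b₀ × Follows δ b₀ a₀ ×
                  (∀ t → A.RunsInTime a₀ t → B.RunsInTime b₀ (factor * g t))

{-# OPTIONS --safe #-}
-- A configuration of the Turing machine is kept as a word in a queue.  One pass
-- through the queue, which pops every letter of the word and pushes those of the
-- successor configuration, simulates one step.  A Wang B machine cannot erase,
-- so it keeps its queue on a stretch of tape that drifts to the right: it pops a
-- letter by setting a flag next to it, walks to the blank part of the tape, writes
-- the new letters there, and walks back to the last letter with its flag set.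
-- The jumps are conditional, but can be placed where the symbol read is known to
-- be 1, since each letter ends with a 1.  With O(t) letters in the queue, each
-- costing O(t) steps in each of t passes, the simulation takes O(t³) steps.

module Submission where

open import Defs
open import Data.Bool.Base using (Bool; true; false)
open import Data.Fin.Base using (Fin; zero; suc; toℕ; fromℕ<; inject₁; _↑ˡ_; _↑ʳ_; splitAt)
open import Data.Fin.Properties using (toℕ<n; toℕ-fromℕ; toℕ-fromℕ<; toℕ-inject₁; toℕ-injective; splitAt-↑ˡ; splitAt-↑ʳ)
open import Data.Fin.Relation.Unary.Top using (view; ‵fromℕ; ‵inject₁)
open import Data.Integer.Base as ℤ using (-[1+_])
open import Data.List.Base using (List; []; _∷_; _++_; _∷ʳ_; _ʳ++_; [_]; length; map; drop; replicate; reverse)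
  renaming (head to head?)
open import Data.List.Properties using (++-assoc; ++-identityʳ; ++-ʳ++; drop-drop; length-++; length-++-≤ˡ; length-++-≤ʳ;
  length-drop; length-map; length-replicate; length-reverse; length-ʳ++; map-++; unfold-reverse)
open import Data.Maybe.Base as Maybe using (Maybe; just; nothing; fromMaybe; _>>=_)
open import Data.Maybe.Properties using (map-id)
open import Data.Nat.Base
open import Data.Nat.Properties
open import Data.Nat.Solver using (module +-*-Solver)
open import Data.Product.Base using (_×_; _,_; ∃-syntax)
open import Data.Sum.Base using ([_,_]′)
open import Data.Vec.Base as Vec using (fromList)
open import Function.Bundles using (mk⇔)
open import Relation.Binary.PropositionalEquality hiding ([_]; J)
open import Relation.Nullary using (yes; no; contradiction)
open +-*-Solver using (solve; con; _:+_; _:*_; _:=_)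

-- Tapes and runs

-- A Wang B machine has no memory besides its tape and its instruction index. So the program
-- contains a separate handler for every pair of a state and a popped letter, and a letter is
-- recognised by the index at which the scan of its one-hot code is left by a jump. Cells only ever
-- change from 0 to 1, and a popped letter is not visited again once its pop is complete; hence the
-- invariants leave the tape to the left of the head arbitrary. Contents and resources are treated
-- apart. Programs are verified up to `∼`, equality of bi-infinite tapes, together with exact step
-- counts, because walking to and fro enlarges windows by blanks. Space is recovered afterwards: the
-- width grows by at most one per step. One discrepancy of windows remains: the encoder reads the
-- minimal window of the input, while the time of the Turing machine is measured on the given one,
-- so its runs on two windows of one tape have to be compared.

infix 4 _∼_

_∼_ : Tape → Tape → Set
t ∼ t′ = ∀ z → cell t z ≡ cell t′ z

∼-refl : ∀ {t} → t ∼ t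
∼-refl z = refl

∼-sym : ∀ {t t′} → t ∼ t′ → t′ ∼ t
∼-sym t∼t′ z = sym (t∼t′ z)

∼-trans : ∀ {t t′ t″} → t ∼ t′ → t′ ∼ t″ → t ∼ t″
∼-trans p q z = trans (p z) (q z)

≡⇒∼ : ∀ {t t′} → t ≡ t′ → t ∼ t′
≡⇒∼ refl = ∼-refl

cell-move-R : ∀ t z → cell (move R t) z ≡ cell t (ℤ.suc z)
cell-move-R (tape ls h [])       (ℤ.+ zero)       = refl
cell-move-R (tape ls h (r ∷ rs)) (ℤ.+ zero)       = refl
cell-move-R (tape ls h [])       (ℤ.+ suc i)      = refl
cell-move-R (tape ls h (r ∷ rs)) (ℤ.+ suc i)      = refl
cell-move-R (tape ls h [])       -[1+ zero ]      = refl
cell-move-R (tape ls h (r ∷ rs)) -[1+ zero ]      = refl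
cell-move-R (tape ls h [])       -[1+ suc i ]     = refl
cell-move-R (tape ls h (r ∷ rs)) -[1+ suc i ]     = refl

cell-move-L : ∀ t z → cell (move L t) z ≡ cell t (ℤ.pred z)
cell-move-L (tape [] h rs)       (ℤ.+ zero)          = refl
cell-move-L (tape (l ∷ ls) h rs) (ℤ.+ zero)          = refl
cell-move-L (tape [] h rs)       (ℤ.+ suc zero)      = refl
cell-move-L (tape (l ∷ ls) h rs) (ℤ.+ suc zero)      = refl
cell-move-L (tape [] h rs)       (ℤ.+ suc (suc i))   = refl
cell-move-L (tape (l ∷ ls) h rs) (ℤ.+ suc (suc i))   = refl
cell-move-L (tape [] h rs)       -[1+ i ]            = refl
cell-move-L (tape (l ∷ ls) h rs) -[1+ i ]            = refl

move-∼ : ∀ D {t t′} → t ∼ t′ → move D t ∼ move D t′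
move-∼ R {t} {t′} p z = trans (cell-move-R t z) (trans (p (ℤ.suc z)) (sym (cell-move-R t′ z)))
move-∼ L {t} {t′} p z = trans (cell-move-L t z) (trans (p (ℤ.pred z)) (sym (cell-move-L t′ z)))

write-∼ : ∀ x {t t′} → t ∼ t′ → write x t ∼ write x t′
write-∼ x p (ℤ.+ zero)  = refl
write-∼ x p (ℤ.+ suc i) = p (ℤ.+ suc i)
write-∼ x p -[1+ i ]  = p -[1+ i ]

nth-consUnlessBlank : ∀ b bs i → nth (consUnlessBlank b bs) i ≡ nth (b ∷ bs) i
nth-consUnlessBlank false []       zero    = refl
nth-consUnlessBlank false []       (suc i) = refl
nth-consUnlessBlank false (_ ∷ _)  i       = refl
nth-consUnlessBlank true  bs       i       = refl

nth-dropOuterBlanks : ∀ bs i → nth (dropOuterBlanks bs) i ≡ nth bs i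
nth-dropOuterBlanks []       i       = refl
nth-dropOuterBlanks (b ∷ bs) zero    = nth-consUnlessBlank b (dropOuterBlanks bs) zero
nth-dropOuterBlanks (b ∷ bs) (suc i) =
  trans (nth-consUnlessBlank b (dropOuterBlanks bs) (suc i)) (nth-dropOuterBlanks bs i)

minimise-∼ : ∀ t → minimise t ∼ t
minimise-∼ (tape ls h rs) (ℤ.+ zero)  = refl
minimise-∼ (tape ls h rs) (ℤ.+ suc i) = nth-dropOuterBlanks rs i
minimise-∼ (tape ls h rs) -[1+ i ]  = nth-dropOuterBlanks ls i

dropOuterBlanks-cong : ∀ as bs → (∀ i → nth as i ≡ nth bs i) → dropOuterBlanks as ≡ dropOuterBlanks bs
dropOuterBlanks-cong []       []       p = refl
dropOuterBlanks-cong []       (b ∷ bs) p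
  rewrite sym (p zero) | sym (dropOuterBlanks-cong [] bs λ i → p (suc i)) = refl
dropOuterBlanks-cong (a ∷ as) []       p
  rewrite p zero | dropOuterBlanks-cong as [] λ i → p (suc i) = refl
dropOuterBlanks-cong (a ∷ as) (b ∷ bs) p =
  cong₂ consUnlessBlank (p zero) (dropOuterBlanks-cong as bs λ i → p (suc i))

dropOuterBlanks-end : ∀ bs → dropOuterBlanks (bs ++ [ true ]) ≡ bs ++ [ true ]
dropOuterBlanks-end []           = refl
dropOuterBlanks-end (true ∷ bs)  = cong (true ∷_) (dropOuterBlanks-end bs)
dropOuterBlanks-end (false ∷ bs) rewrite dropOuterBlanks-end bs = cons bs
  where
  cons : ∀ bs → consUnlessBlank false (bs ++ [ true ]) ≡ false ∷ bs ++ [ true ]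
  cons []      = refl
  cons (_ ∷ _) = refl

length-dropOuterBlanks : ∀ bs → length (dropOuterBlanks bs) ≤ length bs
length-dropOuterBlanks []       = z≤n
length-dropOuterBlanks (b ∷ bs) =
  ≤-trans (length-consUnlessBlank b (dropOuterBlanks bs)) (s≤s (length-dropOuterBlanks bs))
  where
  length-consUnlessBlank : ∀ b bs → length (consUnlessBlank b bs) ≤ suc (length bs)
  length-consUnlessBlank false []      = z≤n
  length-consUnlessBlank false (_ ∷ _) = ≤-refl
  length-consUnlessBlank true  _       = ≤-refl

width-minimise : ∀ t → width (minimise t) ≤ width t
width-minimise (tape ls h rs) = +-mono-≤ (length-dropOuterBlanks ls) (s≤s (length-dropOuterBlanks rs))

width-move-≤ : ∀ D t → width (move D t) ≤ suc (width t)
width-move-≤ L (tape []       h rs) = ≤-refl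
width-move-≤ L (tape (l ∷ ls) h rs) = m≤n⇒m≤1+n (≤-reflexive (+-suc (length ls) (suc (length rs))))
width-move-≤ R (tape ls h [])       = ≤-refl
width-move-≤ R (tape ls h (r ∷ rs)) = m≤n⇒m≤1+n (≤-reflexive (sym (+-suc (length ls) (suc (length rs)))))

width-move-≥ : ∀ D t → width t ≤ width (move D t)
width-move-≥ L (tape []       h rs) = n≤1+n _
width-move-≥ L (tape (l ∷ ls) h rs) = ≤-reflexive (sym (+-suc (length ls) (suc (length rs))))
width-move-≥ R (tape ls h [])       = n≤1+n _
width-move-≥ R (tape ls h (r ∷ rs)) = ≤-reflexive (+-suc (length ls) (suc (length rs)))

-- The head cell is counted as the first of the right part, so that walking over a block only moves
-- a prefix of one list to the other, reversed by `ʳ++`.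
⟨_∣_⟩ : List Bool → List Bool → Tape
⟨ ls ∣ []     ⟩ = tape ls false []
⟨ ls ∣ h ∷ rs ⟩ = tape ls h rs

Blank : List Bool → Set
Blank bs = ∀ i → nth bs i ≡ false

blank-replicate : ∀ n → Blank (replicate n false)
blank-replicate zero    i       = refl
blank-replicate (suc n) zero    = refl
blank-replicate (suc n) (suc i) = blank-replicate n i

blank-++ : ∀ as {bs} → Blank as → Blank bs → Blank (as ++ bs)
blank-++ []       p q i       = q i
blank-++ (a ∷ as) p q zero    = p zero
blank-++ (a ∷ as) p q (suc i) = blank-++ as (λ j → p (suc j)) q i

∼-blank : ∀ {ls} bs → Blank bs → ⟨ ls ∣ [] ⟩ ∼ ⟨ ls ∣ bs ⟩
∼-blank []       p z         = refl
∼-blank (b ∷ bs) p (ℤ.+ zero)  = sym (p zero)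
∼-blank (b ∷ bs) p (ℤ.+ suc i) = sym (p (suc i))
∼-blank (b ∷ bs) p -[1+ i ]  = refl

∼-blanks : ∀ {ls h} bs → Blank bs → ⟨ ls ∣ h ∷ [] ⟩ ∼ ⟨ ls ∣ h ∷ bs ⟩
∼-blanks bs p (ℤ.+ zero)  = refl
∼-blanks bs p (ℤ.+ suc i) = sym (p i)
∼-blanks bs p -[1+ i ]  = refl

move-R-⟨⟩ : ∀ ls x rs → move R ⟨ ls ∣ x ∷ rs ⟩ ≡ ⟨ x ∷ ls ∣ rs ⟩
move-R-⟨⟩ ls x []       = refl
move-R-⟨⟩ ls x (r ∷ rs) = refl

-- Only up to `∼`: when the head comes from beyond the right end, the blank it leaves becomes an
-- explicit cell of the window.
move-L-⟨⟩ : ∀ ls x rs → move L ⟨ x ∷ ls ∣ rs ⟩ ∼ ⟨ ls ∣ x ∷ rs ⟩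
move-L-⟨⟩ ls x []       (ℤ.+ zero)        = refl
move-L-⟨⟩ ls x []       (ℤ.+ suc zero)    = refl
move-L-⟨⟩ ls x []       (ℤ.+ suc (suc i)) = refl
move-L-⟨⟩ ls x []       -[1+ i ]        = refl
move-L-⟨⟩ ls x (r ∷ rs) z               = refl

-- Straight-line sequences of moves and marks

data Op : Set where
  go   : Direction → Op
  mark : Op

perform : Op → Tape → Tape
perform (go D) = move D
perform mark   = write true

perform* : List Op → Tape → Tape
perform* []       t = t
perform* (o ∷ os) t = perform* os (perform o t)

perform-∼ : ∀ o {t t′} → t ∼ t′ → perform o t ∼ perform o t′
perform-∼ (go D) = move-∼ D
perform-∼ mark   = write-∼ true

perform*-∼ : ∀ os {t t′} → t ∼ t′ → perform* os t ∼ perform* os t′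
perform*-∼ []       p = p
perform*-∼ (o ∷ os) p = perform*-∼ os (perform-∼ o p)

perform*-++ : ∀ os os′ t → perform* (os ++ os′) t ≡ perform* os′ (perform* os t)
perform*-++ []       os′ t = refl
perform*-++ (o ∷ os) os′ t = perform*-++ os os′ (perform o t)

-- Splits off the last of several equal operations instead of the first: on the way back over
-- `x ∷ xs`, the cell `x` is met last.
perform*-replicate : ∀ n o t → perform* (replicate n o) (perform o t) ≡ perform o (perform* (replicate n o) t)
perform*-replicate zero    o t = refl
perform*-replicate (suc n) o t = perform*-replicate n o (perform o t)

forwards backwards : ℕ → List Op
forwards  n = replicate n (go R)
backwards n = replicate n (go L)

perform*-forwards : ∀ {n ls rs} xs → length xs ≡ n →
                    perform* (forwards n) ⟨ ls ∣ xs ++ rs ⟩ ≡ ⟨ xs ʳ++ ls ∣ rs ⟩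
perform*-forwards                []       refl = refl
perform*-forwards {ls = ls} {rs} (x ∷ xs) refl
  rewrite move-R-⟨⟩ ls x (xs ++ rs) = perform*-forwards xs refl

perform*-backwards : ∀ {n ls rs} xs → length xs ≡ n →
                     perform* (backwards n) ⟨ xs ʳ++ ls ∣ rs ⟩ ∼ ⟨ ls ∣ xs ++ rs ⟩
perform*-backwards                []       refl = ∼-refl
perform*-backwards {ls = ls} {rs} (x ∷ xs) refl
  rewrite perform*-replicate (length xs) (go L) ⟨ xs ʳ++ (x ∷ ls) ∣ rs ⟩ =
  ∼-trans (move-∼ L (perform*-backwards xs refl)) (move-L-⟨⟩ ls x (xs ++ rs))

module Run (𝓜 : Machine) where
  open Machine 𝓜

  run-+ : ∀ i j {c d} → run i c ≡ just d → run (i + j) c ≡ run j d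
  run-+ i zero    p rewrite +-identityʳ i = p
  run-+ i (suc j) p rewrite +-suc i j = cong (_>>= step) (run-+ i j p)

  run-first : ∀ i {c c′} → step c ≡ just c′ → run (suc i) c ≡ run i c′
  run-first i p = run-+ 1 i p

  run-halted : ∀ i {c} → Halted c → run (suc i) c ≡ nothing
  run-halted zero    p = p
  run-halted (suc i) p rewrite run-halted i p = refl

  run-earlier : ∀ i j {c d} → run (i + j) c ≡ just d → ∃[ e ] run i c ≡ just e
  run-earlier i zero    {d = d} p rewrite +-identityʳ i = d , p
  run-earlier i (suc j) {c}     p rewrite +-suc i j with run (i + j) c in eq
  ... | just _ = run-earlier i j eq

  -- Descending from the undefined time finds the last defined configuration, so halting need not be
  -- decided.
  halts-before : ∀ i {c} → run i c ≡ nothing → HaltsFrom c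
  halts-before (suc i) {c} p with run i c in eq
  ... | nothing = halts-before i eq
  ... | just d  = i , d , eq , p

-- Assembling Wang B programs

-- Jump targets stay symbolic at first, since an address depends on the lengths of the code that
-- contains the jumps. Resolving labels does not change lengths.
data Code (Label : Set) : Set where
  op   : Op → Code Label
  jump : Label → Code Label

module _ {A : Set} where

  drop-length-++ : ∀ (xs : List A) {ys} → drop (length xs) (xs ++ ys) ≡ ys
  drop-length-++ []       = refl
  drop-length-++ (x ∷ xs) = drop-length-++ xs

  drop-<-length : ∀ p (xs : List A) {y ys} → drop p xs ≡ y ∷ ys → p < length xs
  drop-<-length zero    (x ∷ xs) e = s≤s z≤n
  drop-<-length (suc p) (x ∷ xs) e = s≤s (drop-<-length p xs e)

  lookup-map-fromList : ∀ {B : Set} (f : A → B) (xs : List A) {y ys} (j : Fin (length xs)) →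
                        drop (toℕ j) xs ≡ y ∷ ys → Vec.lookup (Vec.map f (fromList xs)) j ≡ f y
  lookup-map-fromList f (x ∷ xs) zero    refl = refl
  lookup-map-fromList f (x ∷ xs) (suc j) e    = lookup-map-fromList f xs j e

  link : ∀ {n} → (Fin n → List A) → List A
  link {zero}  c = []
  link {suc n} c = c zero ++ link (λ i → c (suc i))

  offset : ∀ {n} → (Fin n → List A) → Fin n → ℕ
  offset c zero    = 0
  offset c (suc i) = length (c zero) + offset (λ i → c (suc i)) i

-- The first instruction is kept apart because the number of instructions of a
-- Wang B machine has to be a successor.

module Assembly {Label : Set} (address : Label → ℕ) (first : Code Label) (others : List (Code Label)) where

  program : List (Code Label)
  program = first ∷ others

  end : ℕ
  end = length program

  -- zero is a junk value: every label used has an address before the end.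

  target : Label → Fin end
  target ℓ with address ℓ <? end
  ... | yes p = fromℕ< p
  ... | no  _ = zero

  resolve : Code Label → Instruction end
  resolve (op (go L)) = L
  resolve (op (go R)) = R
  resolve (op mark)   = M
  resolve (jump ℓ)    = J (target ℓ)

  machine : WangB
  machine = record { last = length others ; instructions = Vec.map resolve (fromList program) }

  open Machine (wangB machine) using (step; run; Halted; Configuration)
  open Run (wangB machine)

  record Located (p : ℕ) (c : List (Code Label)) : Set where
    constructor located
    field
      {rest} : List (Code Label)
      drop-≡ : drop p program ≡ c ++ rest

  located-++ˡ : ∀ {p} c {d} → Located p (c ++ d) → Located p c
  located-++ˡ c {d} (located {r} e) = located (trans e (++-assoc c d r))

  located-++ʳ : ∀ {p} c {d} → Located p (c ++ d) → Located (p + length c) d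
  located-++ʳ {p} c {d} (located {r} e) = located (begin
    drop (p + length c) program        ≡⟨ drop-drop p (length c) program ⟨
    drop (length c) (drop p program)   ≡⟨ cong (drop (length c)) e ⟩
    drop (length c) ((c ++ d) ++ r)    ≡⟨ cong (drop (length c)) (++-assoc c d r) ⟩
    drop (length c) (c ++ d ++ r)      ≡⟨ drop-length-++ c ⟩
    d ++ r                             ∎)
    where open ≡-Reasoning

  located-tail : ∀ {p c d} → Located p (c ∷ d) → Located (suc p) d
  located-tail {p} {c} {d} l = subst (λ q → Located q d) (+-comm p 1) (located-++ʳ [ c ] l)

  located-ops : ∀ {p} os {d} → Located p (map op os ++ d) → Located (p + length os) d
  located-ops {p} os l = subst (λ n → Located (p + n) _) (length-map op os) (located-++ʳ (map op os) l)

  located-link : ∀ {n p} (c : Fin n → List (Code Label)) i → Located p (link c) → Located (p + offset c i) (c i)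
  located-link {p = p} c zero    l = subst (λ q → Located q (c zero)) (sym (+-identityʳ p)) (located-++ˡ (c zero) l)
  located-link {p = p} c (suc i) l =
    subst (λ q → Located q (c (suc i))) (+-assoc p (length (c zero)) _)
      (located-link (λ i → c (suc i)) i (located-++ʳ (c zero) l))

  -- A Hoare triple with exact running time. Quantifying over every `T ∼ t` makes it insensitive to
  -- windows, and natural numbers as positions allow arithmetic on addresses.
  record Reach (τ p : ℕ) (t : Tape) (p′ : ℕ) (t′ : Tape) : Set where
    constructor reach
    field
      follow : ∀ {k T} → toℕ k ≡ p → T ∼ t →
               ∃[ k′ ] ∃[ T′ ] run τ (config k T) ≡ just (config k′ T′) × toℕ k′ ≡ p′ × T′ ∼ t′

  open Reach public

  infixr 5 _⨾_

  _⨾_ : ∀ {i j p t p′ t′ p″ t″} → Reach i p t p′ t′ → Reach j p′ t′ p″ t″ → Reach (i + j) p t p″ t″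
  _⨾_ {i} {j} (reach f) (reach g) = reach λ k≡ T∼ →
    let k′ , T′ , e , k′≡ , T′∼ = f k≡ T∼
        k″ , T″ , e′ , k″≡ , T″∼ = g k′≡ T′∼
    in k″ , T″ , trans (run-+ i j e) e′ , k″≡ , T″∼

  reach-∼ : ∀ {τ p t t₁ p′ t′ t₁′} → t₁ ∼ t → t′ ∼ t₁′ → Reach τ p t p′ t′ → Reach τ p t₁ p′ t₁′
  reach-∼ p q (reach f) = reach λ k≡ T∼ →
    let k′ , T′ , e , k′≡ , T′∼ = f k≡ (∼-trans T∼ p)
    in k′ , T′ , e , k′≡ , ∼-trans T′∼ q

  reach-time : ∀ {i j p t p′ t′} → i ≡ j → Reach i p t p′ t′ → Reach j p t p′ t′
  reach-time refl r = r

  reach-at : ∀ {τ p q t p′ t′} → p′ ≡ q → Reach τ p t p′ t′ → Reach τ p t q t′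
  reach-at refl r = r

  stay : ∀ {p t} → Reach 0 p t p t
  stay = reach λ {k} {T} k≡ T∼ → k , T , refl , k≡ , T∼

  step-located : ∀ {p c r} → drop p program ≡ c ∷ r → ∀ {k} T → toℕ k ≡ p →
                 ∃[ j ] toℕ j ≡ p × step (config k T) ≡ just (WangB.execute machine (resolve c) j T)
  step-located {c = c} e {k} T refl with view k
  ... | ‵fromℕ = contradiction (drop-<-length _ program e) (<-irrefl (toℕ-fromℕ end))
  ... | ‵inject₁ j = j , j≡ ,
        cong (λ i → just (WangB.execute machine i j T))
          (lookup-map-fromList resolve program j (subst (λ q → drop q program ≡ _) (sym j≡) e))
    where
    j≡ = sym (toℕ-inject₁ j)

  reach-op : ∀ {p o t} → Located p [ op o ] → Reach 1 p t (suc p) (perform o t)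
  follow (reach-op {o = o} (located e)) {T = T} k≡ T∼ with step-located e T k≡
  follow (reach-op {o = go L} _) _ T∼ | j , j≡ , eq = suc j , _ , eq , cong suc j≡ , move-∼ L T∼
  follow (reach-op {o = go R} _) _ T∼ | j , j≡ , eq = suc j , _ , eq , cong suc j≡ , move-∼ R T∼
  follow (reach-op {o = mark} _) _ T∼ | j , j≡ , eq = suc j , _ , eq , cong suc j≡ , write-∼ true T∼

  toℕ-target : ∀ ℓ → address ℓ < end → toℕ (target ℓ) ≡ address ℓ
  toℕ-target ℓ ℓ< with address ℓ <? end
  ... | yes p = toℕ-fromℕ< p
  ... | no ¬p = contradiction ℓ< ¬p

  located-< : ∀ {p c d} → Located p (c ∷ d) → p < end
  located-< (located e) = drop-<-length _ program e

  -- The substitute for an unconditional jump. The bound on the address excludes the default value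
  -- of `target`.
  reach-jump : ∀ {p ℓ t} → Located p [ jump ℓ ] → address ℓ < end → head t ≡ true → Reach 1 p t (address ℓ) t
  follow (reach-jump {ℓ = ℓ} (located e) ℓ< 1-read) {T = T} k≡ T∼ with step-located e T k≡
  ... | j , _ , eq with head T | T∼ (ℤ.+ 0)
  ...   | true  | _   = inject₁ (target ℓ) , _ , eq , trans (toℕ-inject₁ _) (toℕ-target ℓ ℓ<) , T∼
  ...   | false | 0≡h = contradiction (trans 0≡h 1-read) λ ()

  reach-no-jump : ∀ {p ℓ t} → Located p [ jump ℓ ] → head t ≡ false → Reach 1 p t (suc p) t
  follow (reach-no-jump {ℓ = ℓ} (located e) 0-read) {T = T} k≡ T∼ with step-located e T k≡
  ... | j , j≡ , eq with head T | T∼ (ℤ.+ 0)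
  ...   | true  | 1≡h = contradiction (trans 1≡h 0-read) λ ()
  ...   | false | _   = suc j , _ , eq , cong suc j≡ , T∼

  reach-ops : ∀ {p t} os → Located p (map op os) → Reach (length os) p t (p + length os) (perform* os t)
  reach-ops {p} [] l rewrite +-identityʳ p = stay
  reach-ops {p} (o ∷ os) l rewrite +-suc p (length os) =
    reach-op (located-++ˡ [ op o ] l) ⨾
    reach-ops os (located-tail l)

  end-halted : ∀ {k T} → toℕ k ≡ end → Halted (config k T)
  end-halted {k} k≡ with view k
  ... | ‵fromℕ = refl
  ... | ‵inject₁ j = contradiction (toℕ<n j) (<-irrefl (trans (sym (toℕ-inject₁ j)) k≡))

-- Queue machines as Wang B machines

record Finite (A : Set) : Set where
  field
    size          : ℕ
    index         : A → Fin size
    element       : Fin size → A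
    element-index : ∀ a → element (index a) ≡ a

after : ∀ {n} → Fin n → ℕ
after {suc n} zero    = n
after {suc n} (suc i) = after i

toℕ+after : ∀ {n} (i : Fin n) → toℕ i + suc (after i) ≡ n
toℕ+after {suc n} zero    = refl
toℕ+after {suc n} (suc i) = cong suc (toℕ+after i)

zeros : ℕ → List Bool
zeros n = replicate n false

-- In a queue machine, `δ` consumes the front letter and gives the next state and the word to be
-- pushed at the rear, or `nothing` to halt.
module QueueMachine {State Sym : Set} (states : Finite State) (syms : Finite Sym)
                    (δ : State → Sym → Maybe (State × List Sym)) (start : State) where

  open Finite

  K : ℕ
  K = size syms

  position : Sym → ℕ
  position x = toℕ (index syms x)

  padding : Sym → ℕ
  padding x = after (index syms x)

  -- A letter of the queue occupies K + 2 cells: a flag that is set once the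
  -- letter has been popped, a one-hot code, and a 1 that tells a letter from the
  -- blank part of the tape.

  code body spent : Sym → List Bool
  code x  = zeros (position x) ++ true ∷ zeros (padding x)
  body x  = false ∷ code x
  spent x = true ∷ code x

  length-code : ∀ x → length (code x) ≡ K
  length-code x = begin
    length (code x)                                                ≡⟨ length-++ (zeros (position x)) ⟩
    length (zeros (position x)) + suc (length (zeros (padding x)))  ≡⟨ cong₂ (λ m n → m + suc n) (length-replicate (position x)) (length-replicate (padding x)) ⟩
    position x + suc (padding x)                                   ≡⟨ toℕ+after (index syms x) ⟩
    K                                                              ∎
    where open ≡-Reasoning

  blocks : List Sym → List Bool
  blocks []       = []
  blocks (x ∷ xs) = body x ++ true ∷ blocks xs

  -- The compiled program and its addresses

  data Label : Set where
    entry      : State → Label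
    handle     : State → Sym → Label
    ahead      : State → Sym → Label
    -- These two carry the pushed word, on whose length their addresses depend, so that the
    -- addresses need no second evaluation of `δ`.
    back leave : State → Sym → List Sym → Label
    stop       : Label

  -- The instruction index counts the zeros passed in the one-hot code, and the single 1 triggers
  -- the jump for that count. One of the cells is 1, so control does not run past the last jump.
  scan : ∀ {n} → (Fin n → Label) → List (Code Label)
  scan {zero}  g = []
  scan {suc n} g = op (go R) ∷ jump (g zero) ∷ scan (λ i → g (suc i))

  -- `retire` starts on the 1 of the one-hot code, sets the flag and ends on the closing 1. `append`
  -- starts on the first blank cell, skips the flag cell, which stays 0, and ends just behind the
  -- new letter.
  retire append : Sym → List Op
  retire x = backwards (suc (position x)) ++ mark ∷ forwards (suc K)
  append x = forwards (suc (position x)) ++ mark ∷ forwards (suc (padding x)) ++ mark ∷ go R ∷ []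

  appends : List Sym → List Op
  appends []       = []
  appends (x ∷ xs) = append x ++ appends xs

  -- The width of a letter: it leads from one closing 1 to the next, or to a blank cell if there is
  -- no further letter.
  stride : List Op
  stride = forwards (2 + K)

  turn : List Sym → List Op
  turn ws = backwards (suc K) ++ appends ws ++ go L ∷ []

  handler : State → Sym → Maybe (State × List Sym) → List (Code Label)
  handler s x nothing = jump stop ∷ []
  handler s x (just (s′ , ws)) =
    map op (retire x) ++
    -- Walking out: a 1 means that another letter was crossed, and a 0 that the head has overshot
    -- the queue by one letter's width.
    map op stride ++ jump (ahead s x) ∷
    map op (turn ws) ++
    -- Walking back: each round inspects the flag of a letter. If it is 0, one more move to the left
    -- reaches the closing 1 of the preceding letter, where the jump to `back` is certain to be
    -- taken.
    map op (backwards (suc K)) ++ jump (leave s x ws) ∷ op (go L) ∷ jump (back s x ws) ∷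
    -- From the flag found set to the closing 1 of the same letter, which makes the jump certain and
    -- serves as the left border for the next pop.
    map op (forwards (suc K)) ++ jump (entry s′) ∷ []

  targets : State → Fin K → Label
  targets s i = handle s (element syms i)

  handlers : State → Fin K → List (Code Label)
  handlers s i = handler s (element syms i) (δ s (element syms i))

  stateCode : State → List (Code Label)
  stateCode s = op (go R) ∷ scan (targets s) ++ link (handlers s)

  stateCodes : Fin (size states) → List (Code Label)
  stateCodes i = stateCode (element states i)

  entryAddress : State → ℕ
  entryAddress s = suc (offset stateCodes (index states s))

  handleAddress aheadAddress : State → Sym → ℕ
  handleAddress s x = suc (entryAddress s) + length (scan (targets s)) + offset (handlers s) (index syms x)
  aheadAddress s x  = handleAddress s x + length (retire x)

  backAddress leaveAddress : State → Sym → List Sym → ℕ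
  backAddress s x ws  = suc (aheadAddress s x + length stride) + length (turn ws)
  leaveAddress s x ws = 3 + (backAddress s x ws + length (backwards (suc K)))

  stopAddress : ℕ
  stopAddress = suc (length (link stateCodes))

  address : Label → ℕ
  address (entry s)      = entryAddress s
  address (handle s x)   = handleAddress s x
  address (ahead s x)    = aheadAddress s x
  address (back s x ws)  = backAddress s x ws
  address (leave s x ws) = leaveAddress s x ws
  address stop           = stopAddress

  -- A jump can only lead to an instruction, not to the halted position. The final `go R` is the
  -- landing place from which control falls off the end.
  open Assembly address (jump (entry start)) (link stateCodes ++ [ op (go R) ]) public

  located-states : Located 1 (link stateCodes ++ [ op (go R) ])
  located-states = located {rest = []} (sym (++-identityʳ _))

  located-stop : Located stopAddress [ op (go R) ]
  located-stop = located-++ʳ (link stateCodes) located-states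

  located-entry : ∀ s → Located (entryAddress s) (stateCode s)
  located-entry s = subst (λ s′ → Located (entryAddress s) (stateCode s′)) (element-index states s)
    (located-link stateCodes (index states s) (located-++ˡ (link stateCodes) located-states))

  located-handle : ∀ s x → Located (handleAddress s x) (handler s x (δ s x))
  located-handle s x =
    subst (λ x′ → Located (handleAddress s x) (handler s x′ (δ s x′))) (element-index syms x)
      (located-link (handlers s) (index syms x) (located-++ʳ (scan (targets s)) (located-tail (located-entry s))))

  stop≡ : suc stopAddress ≡ end
  stop≡ = cong suc (begin
    suc (length (link stateCodes))                ≡⟨ +-comm 1 _ ⟩
    length (link stateCodes) + 1                  ≡⟨ length-++ (link stateCodes) ⟨
    length (link stateCodes ++ [ op (go R) ])     ∎)
    where open ≡-Reasoning

  -- Execution of a single pop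

  reach-scan : ∀ {n p y ls X} (g : Fin n → Label) (i : Fin n) → Located p (scan g) → address (g i) < end →
               Reach (2 * suc (toℕ i)) p ⟨ ls ∣ y ∷ zeros (toℕ i) ++ true ∷ X ⟩
                     (address (g i)) ⟨ zeros (toℕ i) ʳ++ y ∷ ls ∣ true ∷ X ⟩
  reach-scan g zero    l g< = reach-op (located-++ˡ [ _ ] l) ⨾ reach-jump (located-++ˡ [ _ ] (located-tail l)) g< refl
  reach-scan g (suc i) l g< rewrite *-suc 2 (suc (toℕ i)) =
    reach-op (located-++ˡ [ _ ] l) ⨾
    reach-no-jump (located-++ˡ [ _ ] (located-tail l)) refl ⨾
    reach-scan (λ i → g (suc i)) i (located-tail (located-tail l)) g<

  scanTime : Sym → ℕ
  scanTime x = 1 + 2 * suc (position x)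

  handle-< : ∀ s x → handleAddress s x < end
  handle-< s x with δ s x | located-handle s x
  ... | nothing       | l = located-< l
  ... | just (s′ , _) | l = located-< l

  reach-handle : ∀ {ls} s x Q →
                 Reach (scanTime x) (entryAddress s) ⟨ ls ∣ true ∷ body x ++ true ∷ Q ⟩
                       (handleAddress s x)
                       ⟨ zeros (suc (position x)) ʳ++ true ∷ ls ∣ true ∷ zeros (padding x) ++ true ∷ Q ⟩
  reach-handle {ls} s x Q =
    reach-op (located-++ˡ [ _ ] (located-entry s)) ⨾
    reach-∼ (≡⇒∼ (cong (λ bs → ⟨ true ∷ ls ∣ false ∷ bs ⟩) (++-assoc (zeros (position x)) (true ∷ zeros (padding x)) (true ∷ Q))))
      ∼-refl
      (subst (λ x′ → Reach (2 * suc (position x)) (suc (entryAddress s))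
                           ⟨ true ∷ ls ∣ false ∷ zeros (position x) ++ true ∷ zeros (padding x) ++ true ∷ Q ⟩ (handleAddress s x′)
                           ⟨ zeros (suc (position x)) ʳ++ true ∷ ls ∣ true ∷ zeros (padding x) ++ true ∷ Q ⟩)
        (element-index syms x)
        (reach-scan (targets s) (index syms x)
          (located-++ˡ (scan (targets s)) (located-tail (located-entry s)))
          (handle-< s (element syms (index syms x)))))

  perform*-retire : ∀ {ls} x Q →
    perform* (retire x) ⟨ zeros (suc (position x)) ʳ++ true ∷ ls ∣ true ∷ zeros (padding x) ++ true ∷ Q ⟩
      ∼ ⟨ spent x ʳ++ true ∷ ls ∣ true ∷ Q ⟩
  perform*-retire {ls} x Q
    rewrite perform*-++ (backwards (suc (position x))) (mark ∷ forwards (suc K))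
              ⟨ zeros (suc (position x)) ʳ++ true ∷ ls ∣ true ∷ zeros (padding x) ++ true ∷ Q ⟩ =
    ∼-trans
      (perform*-∼ (mark ∷ forwards (suc K))
        (perform*-backwards {n = suc (position x)} (zeros (suc (position x))) (length-replicate (suc (position x)))))
      (≡⇒∼ (trans
        (cong (λ bs → perform* (forwards (suc K)) ⟨ true ∷ ls ∣ true ∷ bs ⟩)
          (sym (++-assoc (zeros (position x)) (true ∷ zeros (padding x)) (true ∷ Q))))
        (perform*-forwards {n = suc K} (spent x) (cong suc (length-code x)))))

  perform*-append : ∀ {ls} x → perform* (append x) ⟨ ls ∣ [] ⟩ ∼ ⟨ true ∷ (body x ʳ++ ls) ∣ [] ⟩
  perform*-append {ls} x =
    -- The blanks about to be crossed are made explicit, which turns the walks into walks over known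
    -- blocks.
    ∼-trans (perform*-∼ (append x) (∼-blank cells blank)) (≡⇒∼ (begin
      perform* (append x) ⟨ ls ∣ cells ⟩
        ≡⟨ perform*-++ (forwards (suc i)) _ _ ⟩
      perform* (mark ∷ rest) (perform* (forwards (suc i)) ⟨ ls ∣ cells ⟩)
        ≡⟨ cong (perform* (mark ∷ rest)) (perform*-forwards {n = suc i} (zeros (suc i)) (length-replicate (suc i))) ⟩
      perform* rest ⟨ zeros (suc i) ʳ++ ls ∣ (true ∷ zeros j) ++ false ∷ [] ⟩
        ≡⟨ perform*-++ (forwards (suc j)) _ _ ⟩
      perform* (mark ∷ go R ∷ []) (perform* (forwards (suc j)) ⟨ zeros (suc i) ʳ++ ls ∣ (true ∷ zeros j) ++ false ∷ [] ⟩)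
        ≡⟨ cong (perform* (mark ∷ go R ∷ [])) (perform*-forwards {n = suc j} (true ∷ zeros j) (length-replicate (suc j))) ⟩
      ⟨ true ∷ ((true ∷ zeros j) ʳ++ zeros (suc i) ʳ++ ls) ∣ [] ⟩
        ≡⟨ cong (λ bs → ⟨ true ∷ bs ∣ [] ⟩) (++-ʳ++ (zeros (suc i))) ⟨
      ⟨ true ∷ (body x ʳ++ ls) ∣ [] ⟩ ∎))
    where
    open ≡-Reasoning
    i = position x
    j = padding x
    rest = forwards (suc j) ++ mark ∷ go R ∷ []
    cells = zeros (suc i) ++ zeros (suc j) ++ zeros 1
    blank : Blank cells
    blank = blank-++ (zeros (suc i)) (blank-replicate (suc i))
              (blank-++ (zeros (suc j)) (blank-replicate (suc j)) (blank-replicate 1))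

  -- What lies to the left of the final 1 of the topmost letter when the letters
  -- of a stack are written, its bottom first, to the right of a given 1.

  under : List Bool → List Sym → List Bool
  under base []          = base
  under base (x ∷ stack) = body x ʳ++ true ∷ under base stack

  -- The tape to the right of the given 1 after the head has returned over the whole stack, its top
  -- first.
  unwind : List Sym → List Bool → List Bool
  unwind []          Q = Q
  unwind (x ∷ stack) Q = unwind stack (body x ++ true ∷ Q)

  unwind-ʳ++ : ∀ xs stack → unwind (xs ʳ++ stack) [] ≡ unwind stack (blocks xs)
  unwind-ʳ++ []       stack = refl
  unwind-ʳ++ (x ∷ xs) stack = unwind-ʳ++ xs (x ∷ stack)

  perform*-appends : ∀ {base} ws stack → perform* (appends ws) ⟨ true ∷ under base stack ∣ [] ⟩
                                         ∼ ⟨ true ∷ under base (ws ʳ++ stack) ∣ [] ⟩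
  perform*-appends []       stack = ∼-refl
  perform*-appends {base} (x ∷ ws) stack
    rewrite perform*-++ (append x) (appends ws) ⟨ true ∷ under base stack ∣ [] ⟩ =
    ∼-trans (perform*-∼ (appends ws) (perform*-append x)) (perform*-appends ws (x ∷ stack))

  private
    blank : Blank (zeros (suc K) ++ [])
    blank = blank-++ (zeros (suc K)) (blank-replicate (suc K)) (blank-replicate 0)

  perform*-turn : ∀ {base} ws stack →
    perform* (turn ws) ⟨ zeros (suc K) ʳ++ true ∷ under base stack ∣ [] ⟩
      ∼ ⟨ under base (ws ʳ++ stack) ∣ true ∷ [] ⟩
  perform*-turn {base} ws stack
    rewrite perform*-++ (backwards (suc K)) (appends ws ++ go L ∷ []) ⟨ zeros (suc K) ʳ++ true ∷ under base stack ∣ [] ⟩ =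
    ∼-trans
      (perform*-∼ (appends ws ++ go L ∷ []) (∼-trans
        (perform*-backwards {n = suc K} {rs = []} (zeros (suc K)) (length-replicate (suc K)))
        (∼-sym (∼-blank (zeros (suc K) ++ []) blank))))
      (∼-trans
        (≡⇒∼ (perform*-++ (appends ws) (go L ∷ []) ⟨ true ∷ under base stack ∣ [] ⟩))
        (∼-trans (move-∼ L (perform*-appends ws stack)) (move-L-⟨⟩ _ true [])))

  module _ {p ℓ d} (l : Located p (map op stride ++ jump ℓ ∷ d)) (p≡ : address ℓ ≡ p) where

    private
      located-jump : Located (p + length stride) [ jump ℓ ]
      located-jump = located-++ˡ [ _ ] (located-ops stride l)

    -- By `p≡` the jump closes a loop around the stride. There is one stride per remaining letter,
    -- and one more that lands on a blank and leaves the loop.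
    reach-ahead : ∀ {base} stack qs →
      Reach (suc (length qs) * (length stride + 1)) p ⟨ under base stack ∣ true ∷ blocks qs ⟩
            (suc (p + length stride)) ⟨ zeros (suc K) ʳ++ true ∷ under base (qs ʳ++ stack) ∣ [] ⟩
    reach-ahead {base} stack [] rewrite +-identityʳ (length stride + 1) =
      reach-∼ (∼-blanks (zeros (suc K) ++ []) blank)
              (≡⇒∼ (perform*-forwards {n = 2 + K} (true ∷ zeros (suc K)) (length-replicate (2 + K))))
              (reach-ops stride (located-++ˡ (map op stride) l)) ⨾
      reach-no-jump located-jump refl
    reach-ahead {base} stack (x ∷ qs) = reach-time (sym (+-assoc (length stride) 1 _))
      (reach-∼ ∼-refl (≡⇒∼ (perform*-forwards {n = 2 + K} (true ∷ body x) (cong (2 +_) (length-code x))))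
         (reach-ops stride (located-++ˡ (map op stride) l)) ⨾
       reach-at p≡ (reach-jump located-jump (subst (_< end) (sym p≡) (located-< l)) refl) ⨾
       reach-ahead (x ∷ stack) qs)

  module _ {s : State} {x : Sym} {ws : List Sym} {d : List (Code Label)} {ls : List Bool}
           (l : Located (backAddress s x ws)
                  (map op (backwards (suc K)) ++ jump (leave s x ws) ∷ op (go L) ∷ jump (back s x ws) ∷ d))
           (leave-< : leaveAddress s x ws < end) where

    private
      p  = backAddress s x ws
      os = backwards (suc K)

      base = spent x ʳ++ true ∷ ls

      located-jumps : Located (p + length os) (jump (leave s x ws) ∷ op (go L) ∷ jump (back s x ws) ∷ d)
      located-jumps = located-ops os l

    -- Among the letters met, only the one just retired has its flag set, so the walk crosses the
    -- stack and stops there. Letters popped earlier are hidden in `ls` and never reached.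
    reach-back : ∀ stack Q →
      Reach (length stack * (length os + 3) + (length os + 1)) p ⟨ under base stack ∣ true ∷ Q ⟩
            (leaveAddress s x ws) ⟨ true ∷ ls ∣ spent x ++ true ∷ unwind stack Q ⟩
    reach-back [] Q =
      reach-∼ ∼-refl (perform*-backwards {n = suc K} (spent x) (cong suc (length-code x)))
        (reach-ops os (located-++ˡ (map op os) l)) ⨾
      reach-jump (located-++ˡ [ _ ] located-jumps) leave-< refl
    reach-back (y ∷ stack) Q = reach-time (trans (sym (+-assoc (length os) 3 _)) (sym (+-assoc (length os + 3) (length stack * (length os + 3)) _)))
      (reach-∼ ∼-refl (perform*-backwards {n = suc K} {true ∷ under base stack} {true ∷ Q} (body y) (cong suc (length-code y)))
         (reach-ops os (located-++ˡ (map op os) l)) ⨾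
       reach-no-jump (located-++ˡ [ _ ] located-jumps) refl ⨾
       reach-∼ ∼-refl (move-L-⟨⟩ _ true _) (reach-op (located-++ˡ [ _ ] (located-tail located-jumps))) ⨾
       reach-jump (located-++ˡ [ _ ] (located-tail (located-tail located-jumps))) (located-< l) refl ⨾
       reach-back stack (body y ++ true ∷ Q))

  popTime : Sym → List Sym → ℕ → ℕ
  popTime x ws m =
    scanTime x + (length (retire x) + (suc m * (length stride + 1) + (length (turn ws) +
    (((length ws + m) * (length (backwards (suc K)) + 3) + (length (backwards (suc K)) + 1)) +
    (length (forwards (suc K)) + 1)))))

  -- The invariant of the simulation is restored one letter further to the right: the closing 1 of
  -- the popped letter takes over the role of the 1 under the head, and the spent letter joins the
  -- arbitrary left part.
  reach-pop : ∀ {s x s′ ws ls} → δ s x ≡ just (s′ , ws) → ∀ qs →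
              Reach (popTime x ws (length qs))
                    (entryAddress s) ⟨ ls ∣ true ∷ blocks (x ∷ qs) ⟩
                    (entryAddress s′) ⟨ spent x ʳ++ true ∷ ls ∣ true ∷ blocks (qs ++ ws) ⟩
  reach-pop {s} {x} {s′} {ws} {ls} e qs =
    reach-handle s x (blocks qs) ⨾
    reach-∼ ∼-refl (perform*-retire x (blocks qs)) (reach-ops (retire x) (located-++ˡ (map op (retire x)) l)) ⨾
    reach-ahead l₁ refl [] qs ⨾
    reach-∼ ∼-refl (perform*-turn ws (qs ʳ++ [])) (reach-ops (turn ws) (located-++ˡ (map op (turn ws)) l₂)) ⨾
    reach-time (cong (λ m → m * (length (backwards (suc K)) + 3) + (length (backwards (suc K)) + 1)) length-stack)
      (reach-back l₃ (located-< l₄) (ws ʳ++ (qs ʳ++ [])) []) ⨾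
    reach-∼ ∼-refl
      (≡⇒∼ (trans
        (perform*-forwards {n = suc K} (spent x) (cong suc (length-code x)))
        (cong (λ bs → ⟨ spent x ʳ++ true ∷ ls ∣ true ∷ bs ⟩) queue)))
      (reach-ops (forwards (suc K)) (located-++ˡ (map op (forwards (suc K))) l₄)) ⨾
    reach-jump (located-ops (forwards (suc K)) l₄) (located-< (located-entry s′)) refl
    where
    l  = subst (λ r → Located (handleAddress s x) (handler s x r)) e (located-handle s x)
    l₁ = located-ops (retire x) l
    l₂ = located-tail (located-ops stride l₁)
    l₃ = located-ops (turn ws) l₂
    l₄ = located-tail (located-tail (located-tail (located-ops (backwards (suc K)) l₃)))

    length-stack : length (ws ʳ++ (qs ʳ++ [])) ≡ length ws + length qs
    length-stack = trans (length-ʳ++ ws) (cong (length ws +_) (trans (length-ʳ++ qs) (+-identityʳ _)))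

    queue : unwind (ws ʳ++ (qs ʳ++ [])) [] ≡ blocks (qs ++ ws)
    queue = trans (cong (λ stack → unwind stack []) (sym (++-ʳ++ qs))) (unwind-ʳ++ (qs ++ ws) [])

  reach-stop : ∀ {s x ls} → δ s x ≡ nothing → ∀ qs →
               ∃[ t′ ] Reach (scanTime x + 2) (entryAddress s) ⟨ ls ∣ true ∷ blocks (x ∷ qs) ⟩ end t′
  reach-stop {s} {x} e qs = _ , (
    reach-handle s x (blocks qs) ⨾
    reach-jump (located-++ˡ [ _ ] l) (located-< located-stop) refl ⨾
    reach-at stop≡ (reach-op located-stop))
    where
    l = subst (λ r → Located (handleAddress s x) (handler s x r)) e (located-handle s x)

  -- Cost of feeding a word through the queue

  unit : ℕ
  unit = 12 * (K + 4)

  length-appends : ∀ ws → length (appends ws) ≡ length ws * (K + 4)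
  length-appends []       = refl
  length-appends (x ∷ ws) = begin
    length (append x ++ appends ws)           ≡⟨ length-++ (append x) ⟩
    length (append x) + length (appends ws)   ≡⟨ cong₂ _+_ length-append (length-appends ws) ⟩
    (K + 4) + length ws * (K + 4)             ∎
    where
    open ≡-Reasoning
    i = position x
    j = padding x
    length-append : length (append x) ≡ K + 4
    length-append = begin
      length (append x)
        ≡⟨ length-++ (forwards (suc i)) ⟩
      length (forwards (suc i)) + suc (length (forwards (suc j) ++ mark ∷ go R ∷ []))
        ≡⟨ cong₂ (λ m n → m + suc n) (length-replicate (suc i)) (trans (length-++ (forwards (suc j))) (cong (_+ 2) (length-replicate (suc j)))) ⟩
      suc i + suc (suc j + 2)
        ≡⟨ solve 2 (λ i j → con 1 :+ i :+ (con 1 :+ (con 1 :+ j :+ con 2)) := i :+ (con 1 :+ j) :+ con 4) refl i j ⟩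
      (i + suc j) + 4
        ≡⟨ cong (_+ 4) (toℕ+after (index syms x)) ⟩
      K + 4 ∎

  -- With `position x` bounded by `K`, a pop costs at most 8K + 12 steps, plus 2K + 7 for each
  -- remaining letter and 2K + 8 for each pushed one. The generous `unit` dominates all three
  -- coefficients, and the summand added in the proof is the slack.
  popTime-≤ : ∀ x ws m → popTime x ws m ≤ unit * suc (m + length ws)
  popTime-≤ x ws m = begin
    popTime x ws m
      ≡⟨ cong₂ (λ a b → scanTime x + (a + b)) length-retire (cong₂ (λ a b → suc m * (a + 1) + b) (length-replicate (2 + K))
           (cong₂ _+_ length-turn (cong₂ _+_ (cong (λ n → (w + m) * (n + 3) + (n + 1)) (length-replicate (suc K))) (cong (_+ 1) (length-replicate (suc K)))))) ⟩
    (1 + 2 * suc (position x)) + ((suc (position x) + suc (suc K)) + remainder)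
      ≤⟨ +-mono-≤ (s≤s (*-monoʳ-≤ 2 i<K)) (+-monoˡ-≤ remainder (+-monoˡ-≤ (suc (suc K)) i<K)) ⟩
    (1 + 2 * K) + ((K + suc (suc K)) + remainder)
      ≤⟨ m≤m+n _ ((4 * K + 36) + m * (10 * K + 41) + w * (10 * K + 40)) ⟩
    (1 + 2 * K) + ((K + suc (suc K)) + remainder) + ((4 * K + 36) + m * (10 * K + 41) + w * (10 * K + 40))
      ≡⟨ solve 3 (λ K m w →
           (con 1 :+ con 2 :* K) :+ ((K :+ (con 2 :+ K)) :+
             ((con 1 :+ m) :* ((con 2 :+ K) :+ con 1) :+ (((con 1 :+ K) :+ (w :* (K :+ con 4) :+ con 1)) :+
               (((w :+ m) :* ((con 1 :+ K) :+ con 3) :+ ((con 1 :+ K) :+ con 1)) :+ ((con 1 :+ K) :+ con 1)))))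
           :+ ((con 4 :* K :+ con 36) :+ m :* (con 10 :* K :+ con 41) :+ w :* (con 10 :* K :+ con 40))
           := con 12 :* (K :+ con 4) :* (con 1 :+ (m :+ w))) refl K m w ⟩
    unit * suc (m + w) ∎
    where
    open ≤-Reasoning
    w = length ws
    i<K : position x < K
    i<K = toℕ<n (index syms x)
    remainder = suc m * ((2 + K) + 1) + ((suc K + (w * (K + 4) + 1)) + (((w + m) * (suc K + 3) + (suc K + 1)) + (suc K + 1)))
    length-retire : length (retire x) ≡ suc (position x) + suc (suc K)
    length-retire = trans (length-++ (backwards (suc (position x))))
      (cong₂ (λ m n → m + suc n) (length-replicate (suc (position x))) (length-replicate (suc K)))
    length-turn : length (turn ws) ≡ suc K + (w * (K + 4) + 1)
    length-turn = trans (length-++ (backwards (suc K)))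
      (cong₂ _+_ (length-replicate (suc K)) (trans (length-++ (appends ws)) (cong (_+ 1) (length-appends ws))))

  -- The queue machine viewed as a transducer: it consumes a given input and its pushes are
  -- collected as output, without being popped in turn.
  data Feed : State → List Sym → State → List Sym → Set where
    []  : ∀ {s} → Feed s [] s []
    _∷_ : ∀ {s x xs s′ ws s″ out} → δ s x ≡ just (s′ , ws) → Feed s′ xs s″ out → Feed s (x ∷ xs) s″ (ws ++ out)

  feed-++ : ∀ {s xs s′ out xs′ s″ out′} → Feed s xs s′ out → Feed s′ xs′ s″ out′ → Feed s (xs ++ xs′) s″ (out ++ out′)
  feed-++ []                             fs′ = fs′
  feed-++ (_∷_ {ws = ws} {out = out} f fs) fs′ =
    subst (Feed _ _ _) (sym (++-assoc ws out _)) (f ∷ feed-++ fs fs′)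

  -- `N` bounds the letters in the queue together with those still to be pushed, a total that each
  -- pop lowers by one; so each pop costs at most `unit * N`. The lower bound on `τ` is what makes
  -- simulated steps take positive time.
  reach-feed : ∀ {s xs s′ out ls} N → Feed s xs s′ out → ∀ ys → length (xs ++ ys) + length out ≤ N →
               ∃[ τ ] ∃[ ls′ ] length xs ≤ τ × τ ≤ length xs * (unit * N) ×
               Reach τ (entryAddress s) ⟨ ls ∣ true ∷ blocks (xs ++ ys) ⟩
                       (entryAddress s′) ⟨ ls′ ∣ true ∷ blocks (ys ++ out) ⟩
  reach-feed {ls = ls} N [] ys _ rewrite ++-identityʳ ys = 0 , ls , z≤n , z≤n , stay
  reach-feed N (_∷_ {x = x} {xs} {ws = ws} {out = out} f fs) ys N≥ =
    -- Induction with a larger `ys`: the letters just pushed queue up behind the input not yet read.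
    let τ , ls′ , τ≥ , τ≤ , r = reach-feed N fs (ys ++ ws) (≤-trans (≤-reflexive lengths) (≤-trans (n≤1+n _) N≥))
    in popTime x ws m + τ , ls′ , +-mono-≤ {1} (s≤s z≤n) τ≥ ,
       +-mono-≤ (≤-trans (popTime-≤ x ws m) (*-monoʳ-≤ unit (≤-trans (s≤s (+-monoʳ-≤ m (length-++-≤ˡ ws))) N≥))) τ≤ ,
       reach-∼ ∼-refl (queue-∼ (++-assoc xs ys ws)) (reach-pop f (xs ++ ys)) ⨾ reach-∼ ∼-refl (queue-∼ (++-assoc ys ws out)) r
    where
    m = length (xs ++ ys)
    queue-∼ : ∀ {bs zs zs′} → zs ≡ zs′ → ⟨ bs ∣ true ∷ blocks zs ⟩ ∼ ⟨ bs ∣ true ∷ blocks zs′ ⟩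
    queue-∼ e = ≡⇒∼ (cong (λ zs → ⟨ _ ∣ true ∷ blocks zs ⟩) e)
    lengths : length (xs ++ ys ++ ws) + length out ≡ m + length (ws ++ out)
    lengths = begin
      length (xs ++ ys ++ ws) + length out     ≡⟨ cong (λ zs → length zs + length out) (++-assoc xs ys ws) ⟨
      length ((xs ++ ys) ++ ws) + length out   ≡⟨ cong (_+ length out) (length-++ (xs ++ ys)) ⟩
      m + length ws + length out               ≡⟨ +-assoc m (length ws) (length out) ⟩
      m + (length ws + length out)             ≡⟨ cong (m +_) (length-++ ws) ⟨
      m + length (ws ++ out)                   ∎
      where open ≡-Reasoning

  scanTime-≤ : ∀ x → scanTime x + 2 ≤ unit
  scanTime-≤ x = begin
    1 + 2 * suc (position x) + 2        ≤⟨ +-monoˡ-≤ 2 (s≤s (*-monoʳ-≤ 2 (toℕ<n (index syms x)))) ⟩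
    1 + 2 * K + 2                       ≤⟨ m≤m+n _ (10 * K + 45) ⟩
    1 + 2 * K + 2 + (10 * K + 45)       ≡⟨ solve 1 (λ K → con 1 :+ con 2 :* K :+ con 2 :+ (con 10 :* K :+ con 45) := con 12 :* (K :+ con 4)) refl K ⟩
    unit                                ∎
    where open ≤-Reasoning

  reach-feed-stop : ∀ {s xs s′ out x ls} N → Feed s xs s′ out → δ s′ x ≡ nothing → ∀ ys → length (xs ++ x ∷ ys) + length out ≤ N →
                    ∃[ τ ] ∃[ t′ ] τ ≤ suc (length xs) * (unit * N) ×
                    Reach τ (entryAddress s) ⟨ ls ∣ true ∷ blocks (xs ++ x ∷ ys) ⟩ end t′
  reach-feed-stop {xs = xs} {out = out} {x} {ls} N fs e ys N≥ =
    let τ , ls′ , _ , τ≤ , r = reach-feed {ls = ls} N fs (x ∷ ys) N≥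
        t′ , r′ = reach-stop {ls = ls′} e (ys ++ out)
    in τ + (scanTime x + 2) , t′ , bound τ≤ , r ⨾ r′
    where
    open ≤-Reasoning
    N>0 : 0 < N
    N>0 = begin
      1                                     ≤⟨ s≤s z≤n ⟩
      length (x ∷ ys)                       ≤⟨ length-++-≤ʳ (x ∷ ys) {xs} ⟩
      length (xs ++ x ∷ ys)                 ≤⟨ m≤m+n (length (xs ++ x ∷ ys)) (length out) ⟩
      length (xs ++ x ∷ ys) + length out    ≤⟨ N≥ ⟩
      N                                     ∎
    bound : ∀ {τ} → τ ≤ length xs * (unit * N) → τ + (scanTime x + 2) ≤ suc (length xs) * (unit * N)
    bound {τ} τ≤ = begin
      τ + (scanTime x + 2)                   ≤⟨ +-mono-≤ τ≤ (≤-trans (scanTime-≤ x) (m≤m*n unit N {{>-nonZero N>0}})) ⟩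
      length xs * (unit * N) + unit * N      ≡⟨ +-comm (length xs * (unit * N)) (unit * N) ⟩
      suc (length xs) * (unit * N)           ∎

-- Turing machines as queue machines

-- In `carry` the marked letter is still ahead; `goRight q` has just passed it and puts the mark on
-- the next letter; `copy` passes on what remains.
data State (n : ℕ) : Set where
  carry   : Maybe Bool → State n
  goRight : Fin n → State n
  copy    : State n

finite-State : ∀ n → Finite (State n)
finite-State n = record { size = 4 + n ; index = index ; element = element ; element-index = element-index }
  where
  index : State n → Fin (4 + n)
  index (carry nothing)      = zero
  index (carry (just false)) = suc zero
  index (carry (just true))  = suc (suc zero)
  index copy                 = suc (suc (suc zero))
  index (goRight q)          = suc (suc (suc (suc q)))
  element : Fin (4 + n) → State n
  element zero                        = carry nothing
  element (suc zero)                  = carry (just false)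
  element (suc (suc zero))            = carry (just true)
  element (suc (suc (suc zero)))      = copy
  element (suc (suc (suc (suc q))))   = goRight q
  element-index : ∀ s → element (index s) ≡ s
  element-index (carry nothing)      = refl
  element-index (carry (just false)) = refl
  element-index (carry (just true))  = refl
  element-index copy                 = refl
  element-index (goRight q)          = refl

-- nothing ends the queue.

Sym : ℕ → Set
Sym n = Maybe (Letter n)

finite-Sym : ∀ n → Finite (Sym n)
finite-Sym n = record { size = 3 + (n + n) ; index = index ; element = element ; element-index = element-index }
  where
  index : Sym n → Fin (3 + (n + n))
  index nothing                  = zero
  index (just (false , nothing)) = suc zero
  index (just (true  , nothing)) = suc (suc zero)
  index (just (false , just q))  = suc (suc (suc (q ↑ˡ n)))
  index (just (true  , just q))  = suc (suc (suc (n ↑ʳ q)))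
  element : Fin (3 + (n + n)) → Sym n
  element zero                = nothing
  element (suc zero)          = just (false , nothing)
  element (suc (suc zero))    = just (true , nothing)
  element (suc (suc (suc i))) = [ (λ q → just (false , just q)) , (λ q → just (true , just q)) ]′ (splitAt n i)
  element-index : ∀ x → element (index x) ≡ x
  element-index nothing                  = refl
  element-index (just (false , nothing)) = refl
  element-index (just (true  , nothing)) = refl
  element-index (just (false , just q)) rewrite splitAt-↑ˡ n q n = refl
  element-index (just (true  , just q)) rewrite splitAt-↑ʳ n n q = refl

cells : ∀ {n} → List Bool → List (Sym n)
cells bs = map just (map unmarked bs)

cells-++ : ∀ {n} as bs → cells {n} (as ++ bs) ≡ cells as ++ cells bs
cells-++ as bs = trans (cong (map just) (map-++ unmarked as bs)) (map-++ just (map unmarked as) (map unmarked bs))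

length-cells : ∀ {n} bs → length (cells {n} bs) ≡ length bs
length-cells bs = trans (length-map just (map unmarked bs)) (length-map unmarked bs)

queue : ∀ {n} → Config n → List (Sym n)
queue c = map just (word c) ++ [ nothing ]

queue-≡ : ∀ {n} (q : Fin n) ls h rs →
          queue (config q (tape ls h rs)) ≡ cells (reverse ls) ++ just (h , just q) ∷ cells rs ++ [ nothing ]
queue-≡ q ls h rs =
  trans (cong (_++ [ nothing ]) (map-++ just (map unmarked (reverse ls)) _)) (++-assoc (cells (reverse ls)) _ _)

length-queue : ∀ {n} (c : Config n) → length (queue c) ≡ suc (width (contents c))
length-queue (config q (tape ls h rs)) = begin
  length (queue (config q (tape ls h rs)))                                        ≡⟨ cong length (queue-≡ q ls h rs) ⟩
  length (cells (reverse ls) ++ just (h , just q) ∷ cells rs ++ [ nothing ])       ≡⟨ length-++ (cells (reverse ls)) ⟩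
  length (cells (reverse ls)) + suc (length (cells rs ++ [ nothing ]))
    ≡⟨ cong₂ (λ m n → m + suc n) (trans (length-cells (reverse ls)) (length-reverse ls)) (trans (length-++ (cells rs)) (cong (_+ 1) (length-cells rs))) ⟩
  length ls + suc (length rs + 1)                                                 ≡⟨ solve 2 (λ l r → l :+ (con 1 :+ (r :+ con 1)) := con 1 :+ (l :+ (con 1 :+ r))) refl (length ls) (length rs) ⟩
  suc (length ls + suc (length rs))                                               ∎
  where open ≡-Reasoning

-- A window of width `w` gives `w + 1` letters including the end symbol. The factor `2 * w + 3` adds
-- the length of the old queue and that of the new one, at most `w + 2`.
passTime : ℕ → ℕ → ℕ
passTime unit w = suc w * (unit * (2 * w + 3))

module _ (𝓜 : TuringMachine) where

  open TuringMachine 𝓜 using (step; f)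

  width-step-≥ : ∀ {c d} → step c ≡ just d → width (contents c) ≤ width (contents d)
  width-step-≥ {config q t} e with f q (Tape.head t)
  width-step-≥ {config q t} refl | just (x , D , _) = width-move-≥ D (write x t)

  width-step-≤ : ∀ {c d} → step c ≡ just d → width (contents d) ≤ suc (width (contents c))
  width-step-≤ {config q t} e with f q (Tape.head t)
  width-step-≤ {config q t} refl | just (x , D , _) = width-move-≤ D (write x t)

-- One pass over the queue, which pops a configuration and pushes its successor,
-- lags one letter behind in the state carry, until it has read the head: for a
-- move to the left, the mark goes to the letter being held back.

module Pass (M : TuringMachine) where

  open TuringMachine M using (f; last)

  n : ℕ
  n = suc last

  pending : Maybe Bool → List (Sym n)
  pending nothing  = []
  pending (just b) = just (unmarked b) ∷ []

  moved : Maybe Bool → Maybe (Bool × Direction × Fin n) → Maybe (State n × List (Sym n))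
  moved m nothing           = nothing
  moved m (just (x , R , q)) = just (goRight q , pending m ++ just (unmarked x) ∷ [])
  -- With nothing held back, the head leaves the window to the left and the mark goes on a fresh
  -- blank.
  moved m (just (x , L , q)) = just (copy , just (fromMaybe false m , just q) ∷ just (unmarked x) ∷ [])

  δ : State n → Sym n → Maybe (State n × List (Sym n))
  δ (carry m)   nothing              = nothing
  δ (carry m)   (just (b , nothing)) = just (carry (just b) , pending m)
  δ (carry m)   (just (b , just q))  = moved m (f q b)
  δ copy        nothing              = just (carry nothing , nothing ∷ [])
  δ copy        (just l)             = just (copy , just l ∷ [])
  -- The head leaves the window to the right: a marked blank is inserted before the end symbol.
  δ (goRight q) nothing              = just (carry nothing , just (false , just q) ∷ nothing ∷ [])
  δ (goRight q) (just (b , _))       = just (copy , just (b , just q) ∷ [])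

  open QueueMachine (finite-State n) (finite-Sym n) δ (carry nothing) public

  feed-copy : ∀ bs → Feed copy (cells bs ++ [ nothing ]) (carry nothing) (cells bs ++ [ nothing ])
  feed-copy []       = refl ∷ []
  feed-copy (b ∷ bs) = refl ∷ feed-copy bs

  feed-carry : ∀ m bs b → Feed (carry m) (cells (bs ∷ʳ b)) (carry (just b)) (pending m ++ cells bs)
  feed-carry m []       b = refl ∷ []
  feed-carry m (x ∷ bs) b = refl ∷ feed-carry (just x) bs b

  feed-left : ∀ ls → Feed (carry nothing) (cells (reverse ls)) (carry (head? ls)) (cells (reverse (drop 1 ls)))
  feed-left []       = []
  feed-left (l ∷ ls) rewrite unfold-reverse l ls = feed-carry nothing (reverse ls) l

  cells-pending : ∀ ls → cells (reverse (drop 1 ls)) ++ pending (head? ls) ≡ cells (reverse ls)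
  cells-pending []       = refl
  cells-pending (l ∷ ls) = trans (sym (cells-++ (reverse ls) [ l ])) (cong cells (sym (unfold-reverse l ls)))

  moved-right : ∀ ls x (out : List (Sym n)) →
                cells (reverse (drop 1 ls)) ++ (pending (head? ls) ++ just (unmarked x) ∷ []) ++ out ≡ cells (reverse (x ∷ ls)) ++ out
  moved-right ls x out = begin
    cells (reverse (drop 1 ls)) ++ (pending (head? ls) ++ [ just (unmarked x) ]) ++ out
      ≡⟨ ++-assoc (cells (reverse (drop 1 ls))) _ out ⟨
    (cells (reverse (drop 1 ls)) ++ pending (head? ls) ++ [ just (unmarked x) ]) ++ out
      ≡⟨ cong (_++ out) (++-assoc (cells (reverse (drop 1 ls))) (pending (head? ls)) _) ⟨
    ((cells (reverse (drop 1 ls)) ++ pending (head? ls)) ++ [ just (unmarked x) ]) ++ out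
      ≡⟨ cong (λ xs → (xs ++ [ just (unmarked x) ]) ++ out) (cells-pending ls) ⟩
    (cells (reverse ls) ++ cells [ x ]) ++ out
      ≡⟨ cong (_++ out) (cells-++ (reverse ls) [ x ]) ⟨
    cells (reverse ls ∷ʳ x) ++ out
      ≡⟨ cong (λ bs → cells bs ++ out) (unfold-reverse x ls) ⟨
    cells (reverse (x ∷ ls)) ++ out ∎
    where open ≡-Reasoning

  -- The output is the queue of the very window that `move` produces, outer blanks included. Queue
  -- lengths therefore follow widths exactly.
  feed-pass : ∀ {c c′} → TuringMachine.step M c ≡ just c′ → Feed (carry nothing) (queue c) (carry nothing) (queue c′)
  feed-pass {config q (tape ls h rs)} e with f q h in eq
  feed-pass {config q (tape ls h rs)} refl | just (x , R , q′) =
    subst₂ (λ xs out → Feed _ xs _ out) (sym (queue-≡ q ls h rs)) (trans (moved-right ls x _) (pushed rs))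
      (feed-++ (feed-left ls) (cong (moved (head? ls)) eq ∷ feed-right rs))
    where
    right : List Bool → List (Sym n)
    right []       = just (false , just q′) ∷ [ nothing ]
    right (r ∷ rs) = just (r , just q′) ∷ cells rs ++ [ nothing ]
    feed-right : ∀ rs → Feed (goRight q′) (cells rs ++ [ nothing ]) (carry nothing) (right rs)
    feed-right []       = refl ∷ []
    feed-right (r ∷ rs) = refl ∷ feed-copy rs
    pushed : ∀ rs → cells (reverse (x ∷ ls)) ++ right rs ≡ queue (config q′ (move R (tape ls x rs)))
    pushed []       = sym (queue-≡ q′ (x ∷ ls) false [])
    pushed (r ∷ rs) = sym (queue-≡ q′ (x ∷ ls) r rs)
  feed-pass {config q (tape ls h rs)} refl | just (x , L , q′) =
    subst₂ (λ xs out → Feed _ xs _ out) (sym (queue-≡ q ls h rs)) (pushed ls)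
      (feed-++ (feed-left ls) (cong (moved (head? ls)) eq ∷ feed-copy rs))
    where
    pushed : ∀ ls → cells (reverse (drop 1 ls)) ++ just (fromMaybe false (head? ls) , just q′) ∷ cells (x ∷ rs) ++ [ nothing ]
                    ≡ queue (config q′ (move L (tape ls x rs)))
    pushed []       = sym (queue-≡ q′ [] false (x ∷ rs))
    pushed (l ∷ ls) = sym (queue-≡ q′ ls l (x ∷ rs))

  δ-halted : ∀ {q t} m → Machine.Halted (turing M) (config q t) → δ (carry m) (just (Tape.head t , just q)) ≡ nothing
  δ-halted {q} {t} m e with f q (Tape.head t)
  ... | nothing = refl

  Encodes : Config (suc end) → Config n → Set
  Encodes b a = toℕ (control b) ≡ entryAddress (carry nothing) ×
                ∃[ ls ] contents b ∼ ⟨ ls ∣ true ∷ blocks (queue a) ⟩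

  open Machine (wangB machine) using (run; Halted)

  encodes-step : ∀ {a a′} → TuringMachine.step M a ≡ just a′ → ∀ {b} → Encodes b a →
                 ∃[ τ ] ∃[ b′ ] 0 < τ × τ ≤ passTime unit (width (contents a)) × run τ b ≡ just b′ × Encodes b′ a′
  encodes-step {a} {a′} e (k≡ , ls , T∼) =
    let w = width (contents a)
        τ , ls′ , τ≥ , τ≤ , r = reach-feed {ls = ls} (2 * w + 3) (feed-pass e) [] (begin
          length (queue a ++ []) + length (queue a′)   ≡⟨ cong₂ _+_ (trans (cong length (++-identityʳ (queue a))) (length-queue a)) (length-queue a′) ⟩
          suc w + suc (width (contents a′))            ≤⟨ +-monoʳ-≤ (suc w) (s≤s (width-step-≤ M {a} {a′} e)) ⟩
          suc w + suc (suc w)                          ≡⟨ solve 1 (λ w → con 1 :+ w :+ (con 2 :+ w) := con 2 :* w :+ con 3) refl w ⟩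
          2 * w + 3                                    ∎)
        k′ , T′ , run≡ , k′≡ , T′∼ = follow r k≡
          (subst (λ xs → _ ∼ ⟨ ls ∣ true ∷ blocks xs ⟩) (sym (++-identityʳ (queue a))) T∼)
    in τ , config k′ T′ , ≤-trans (subst (1 ≤_) (sym (length-queue a)) (s≤s z≤n)) τ≥ ,
       subst (λ m → τ ≤ m * (unit * (2 * w + 3))) (length-queue a) τ≤ , run≡ , k′≡ , ls′ , T′∼
    where open ≤-Reasoning

  encodes-halted : ∀ {a} → Machine.Halted (turing M) a → ∀ {b} → Encodes b a →
                   ∃[ τ ] ∃[ b′ ] τ ≤ passTime unit (width (contents a)) × run τ b ≡ just b′ × Halted b′
  encodes-halted {config q (tape ls₀ h rs)} e (k≡ , ls , T∼) =
    -- The last pass is incomplete: it transmits the part left of the head and stops at the marked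
    -- letter, for which `f` is undefined.
    let τ , t′ , τ≤ , r = reach-feed-stop {ls = ls} (2 * width (tape ls₀ h rs) + 3) (feed-left ls₀)
                            (δ-halted {q} {tape ls₀ h rs} (head? ls₀) e) (cells rs ++ [ nothing ]) lengths
        k′ , T′ , run≡ , k′≡ , _ = follow r k≡ (subst (λ zs → _ ∼ ⟨ ls ∣ true ∷ blocks zs ⟩) (queue-≡ q ls₀ h rs) T∼)
    in τ , config k′ T′ , ≤-trans τ≤ (*-monoˡ-≤ (unit * (2 * width (tape ls₀ h rs) + 3)) (s≤s shorter)) , run≡ , end-halted k′≡
    where
    open ≤-Reasoning
    shorter : length (cells {n} (reverse ls₀)) ≤ width (tape ls₀ h rs)
    shorter = begin
      length (cells {n} (reverse ls₀))   ≡⟨ length-cells (reverse ls₀) ⟩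
      length (reverse ls₀)               ≡⟨ length-reverse ls₀ ⟩
      length ls₀                         ≤⟨ m≤m+n (length ls₀) _ ⟩
      width (tape ls₀ h rs)              ∎
    w = width (tape ls₀ h rs)
    lengths : length (cells (reverse ls₀) ++ just (h , just q) ∷ cells rs ++ [ nothing ]) + length (cells {n} (reverse (drop 1 ls₀)))
              ≤ 2 * w + 3
    lengths = begin
      length (cells (reverse ls₀) ++ just (h , just q) ∷ cells rs ++ [ nothing ]) + length (cells {n} (reverse (drop 1 ls₀)))
        ≡⟨ cong₂ _+_ (trans (cong length (sym (queue-≡ q ls₀ h rs))) (length-queue (config q (tape ls₀ h rs))))
                     (trans (length-cells (reverse (drop 1 ls₀))) (trans (length-reverse (drop 1 ls₀)) (length-drop 1 ls₀))) ⟩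
      suc w + (length ls₀ ∸ 1)   ≤⟨ +-monoʳ-≤ (suc w) (≤-trans (m∸n≤m (length ls₀) 1) (m≤m+n (length ls₀) _)) ⟩
      suc w + w                  ≤⟨ m≤m+n _ 2 ⟩
      suc w + w + 2              ≡⟨ solve 1 (λ w → con 1 :+ w :+ w :+ con 2 := con 2 :* w :+ con 3) refl w ⟩
      2 * w + 3                  ∎

-- Encoding and decoding

module Coding (M : TuringMachine) where
  open Pass M

  emit : Sym n → List (Letter (suc end))
  emit x = map unmarked (body x ++ [ true ])

  emit-blocks : ∀ x xs → emit x ++ map unmarked (blocks xs) ≡ map unmarked (blocks (x ∷ xs))
  emit-blocks x xs = trans (sym (map-++ unmarked (body x ++ [ true ]) (blocks xs)))
                           (cong (map unmarked) (++-assoc (body x) [ true ] (blocks xs)))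

  -- The first cell, on which the head stands, plays the part of the final 1 of
  -- a letter popped before.

  encoding : Transducer (Letter n) (Letter (suc end))
  encoding = record { states = 2 ; start = zero ; next = next ; final = final }
    where
    next : Fin 2 → Letter n → Fin 2 × List (Letter (suc end))
    next zero    l = suc zero , (true , just zero) ∷ emit (just l)
    next (suc _) l = suc zero , emit (just l)
    final : Fin 2 → Maybe (List (Letter (suc end)))
    final zero    = just ((true , just zero) ∷ emit nothing)
    final (suc _) = just (emit nothing)

  transduceFrom-encoding : ∀ w → Transducer.transduceFrom encoding (suc zero) w ≡ just (map unmarked (blocks (map just w ++ [ nothing ])))
  transduceFrom-encoding []      = refl
  transduceFrom-encoding (l ∷ w) =
    trans (cong (Maybe.map (emit (just l) ++_)) (transduceFrom-encoding w))
          (cong just (emit-blocks (just l) (map just w ++ [ nothing ])))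

  transduce-encoding : ∀ w → Transducer.transduce encoding w ≡ just ((true , just zero) ∷ map unmarked (blocks (map just w ++ [ nothing ])))
  transduce-encoding []      = refl
  transduce-encoding (l ∷ w) =
    trans (cong (Maybe.map (((true , just zero) ∷ emit (just l)) ++_)) (transduceFrom-encoding w))
      (cong (λ u → just ((true , just zero) ∷ u)) (emit-blocks (just l) (map just w ++ [ nothing ])))

  letters : Sym n → List (Letter n)
  letters nothing  = []
  letters (just l) = l ∷ []

  symbol : Fin K → Sym n
  symbol = Finite.element (finite-Sym n)

  -- The decoder ignores the cells before the head (`skip`), passes over a flag (`flag`), counts the
  -- zeros of a one-hot code (`read i`), and passes over the rest of the letter up to its closing 1
  -- (`pad`).
  pattern skip   = zero
  pattern flag   = suc zero
  pattern pad    = suc (suc zero)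
  pattern read i = suc (suc (suc i))

  -- The junk value in the last position is never used.

  successor : Fin K → Fin K
  successor i with suc (toℕ i) <? K
  ... | yes p = fromℕ< p
  ... | no  _ = i

  toℕ-successor : ∀ i → suc (toℕ i) < K → toℕ (successor i) ≡ suc (toℕ i)
  toℕ-successor i i< with suc (toℕ i) <? K
  ... | yes p = toℕ-fromℕ< p
  ... | no ¬p = contradiction i< ¬p

  decoding : Transducer (Letter (suc end)) (Letter n)
  decoding = record { states = 3 + K ; start = skip ; next = next ; final = λ _ → just [] }
    where
    next : Fin (3 + K) → Letter (suc end) → Fin (3 + K) × List (Letter n)
    next skip     (_ , nothing) = skip , []
    next skip     (_ , just _)  = flag , []
    next flag     _             = read zero , []
    next pad      (false , _)   = pad , []
    next pad      (true , _)    = flag , []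
    next (read i) (false , _)   = read (successor i) , []
    next (read i) (true , _)    = pad , letters (symbol i)

  open Transducer decoding using (transduceFrom)

  private
    map-[]-++ : ∀ {A : Set} {r : Maybe (List A)} → Maybe.map ([] ++_) r ≡ r
    map-[]-++ = map-id _

  transduceFrom-skip : ∀ bs w → transduceFrom skip (map unmarked bs ++ w) ≡ transduceFrom skip w
  transduceFrom-skip []       w = refl
  transduceFrom-skip (b ∷ bs) w = trans map-[]-++ (transduceFrom-skip bs w)

  transduceFrom-pad : ∀ j bs → transduceFrom pad (map unmarked (zeros j ++ true ∷ bs)) ≡ transduceFrom flag (map unmarked bs)
  transduceFrom-pad zero    bs = map-[]-++
  transduceFrom-pad (suc j) bs = trans map-[]-++ (transduceFrom-pad j bs)

  transduceFrom-read : ∀ j {i i′} bs → toℕ i′ + j ≡ toℕ i →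
    transduceFrom (read i′) (map unmarked (zeros j ++ true ∷ bs)) ≡
    Maybe.map (letters (symbol i) ++_) (transduceFrom pad (map unmarked bs))
  transduceFrom-read zero {i} {i′} bs e
    rewrite toℕ-injective {i = i′} {j = i} (trans (sym (+-identityʳ (toℕ i′))) e) = refl
  transduceFrom-read (suc j) {i} {i′} bs e = trans map-[]-++ (transduceFrom-read j bs (begin
    toℕ (successor i′) + j   ≡⟨ cong (_+ j) (toℕ-successor i′ (≤-trans (s≤s (≤-trans (m≤m+n (suc (toℕ i′)) j) (≤-reflexive e′))) (toℕ<n i))) ⟩
    suc (toℕ i′) + j         ≡⟨ e′ ⟩
    toℕ i                    ∎))
    where
    open ≡-Reasoning
    e′ : suc (toℕ i′) + j ≡ toℕ i
    e′ = trans (sym (+-suc (toℕ i′) j)) e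

  transduceFrom-blocks : ∀ x xs → transduceFrom flag (map unmarked (blocks (x ∷ xs))) ≡
                                  Maybe.map (letters x ++_) (transduceFrom flag (map unmarked (blocks xs)))
  transduceFrom-blocks x xs = begin
    transduceFrom flag (map unmarked (blocks (x ∷ xs)))
      ≡⟨ map-[]-++ ⟩
    transduceFrom (read zero) (map unmarked (code x ++ true ∷ blocks xs))
      ≡⟨ cong (λ bs → transduceFrom (read zero) (map unmarked bs)) (++-assoc (zeros (position x)) _ _) ⟩
    transduceFrom (read zero) (map unmarked (zeros (position x) ++ true ∷ zeros (padding x) ++ true ∷ blocks xs))
      ≡⟨ transduceFrom-read (position x) _ refl ⟩
    Maybe.map (letters (symbol (Finite.index (finite-Sym n) x)) ++_) (transduceFrom pad (map unmarked (zeros (padding x) ++ true ∷ blocks xs)))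
      ≡⟨ cong₂ (λ y r → Maybe.map (letters y ++_) r) (Finite.element-index (finite-Sym n) x) (transduceFrom-pad (padding x) (blocks xs)) ⟩
    Maybe.map (letters x ++_) (transduceFrom flag (map unmarked (blocks xs))) ∎
    where open ≡-Reasoning

  transduceFrom-queue : ∀ w → transduceFrom flag (map unmarked (blocks (map just w ++ [ nothing ]))) ≡ just w
  transduceFrom-queue []      = transduceFrom-blocks nothing []
  transduceFrom-queue (l ∷ w) =
    trans (transduceFrom-blocks (just l) (map just w ++ [ nothing ])) (cong (Maybe.map (l ∷_)) (transduceFrom-queue w))

  blocks-++ : ∀ xs ys → blocks (xs ++ ys) ≡ blocks xs ++ blocks ys
  blocks-++ []       ys = refl
  blocks-++ (x ∷ xs) ys = trans (cong (λ bs → body x ++ true ∷ bs) (blocks-++ xs ys)) (sym (++-assoc (body x) (true ∷ blocks xs) (blocks ys)))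

  dropOuterBlanks-queue : ∀ a → dropOuterBlanks (blocks (queue a)) ≡ blocks (queue a)
  dropOuterBlanks-queue a = subst (λ bs → dropOuterBlanks bs ≡ bs) (sym ends) (dropOuterBlanks-end (blocks (map just (word a)) ++ body nothing))
    where
    ends : blocks (queue a) ≡ (blocks (map just (word a)) ++ body nothing) ++ [ true ]
    ends = trans (blocks-++ (map just (word a)) [ nothing ]) (sym (++-assoc (blocks (map just (word a))) (body nothing) [ true ]))

  -- The queue ends with a 1, so trimming returns it intact. The left part is only known up to outer
  -- blanks, which the decoder can afford since it skips all of it.
  minimise-queue : ∀ {t ls} a → t ∼ ⟨ ls ∣ true ∷ blocks (queue a) ⟩ →
                   minimise t ≡ tape (dropOuterBlanks (leftward t)) true (blocks (queue a))
  minimise-queue {t} a t∼ = cong₂ (tape (dropOuterBlanks (leftward t))) (t∼ (ℤ.+ 0))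
    (trans (dropOuterBlanks-cong (rightward t) (blocks (queue a)) (λ i → t∼ (ℤ.+ suc i))) (dropOuterBlanks-queue a))

  decode : ∀ {b ls a} → contents b ∼ ⟨ ls ∣ true ∷ blocks (queue a) ⟩ → decoding ⟨ b ⟩↦ a
  decode {b} {ls} {a} T∼ = begin
    transduceFrom skip (word (config (control b) (minimise (contents b))))
      ≡⟨ cong (λ t → transduceFrom skip (word (config (control b) t))) (minimise-queue {contents b} {ls} a T∼) ⟩
    transduceFrom skip (word (config (control b) (tape left true (blocks (queue a)))))
      ≡⟨ transduceFrom-skip (reverse left) ((true , just (control b)) ∷ map unmarked (blocks (queue a))) ⟩
    transduceFrom skip ((true , just (control b)) ∷ map unmarked (blocks (queue a)))
      ≡⟨ map-[]-++ ⟩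
    transduceFrom flag (map unmarked (blocks (queue a)))
      ≡⟨ transduceFrom-queue (word a) ⟩
    just (word a) ∎
    where
    open ≡-Reasoning
    left = dropOuterBlanks (leftward (contents b))

-- The simulation and its running time

module RunWidth (𝓜 : Machine) where
  open Machine 𝓜
  open Run 𝓜

  run-width-≤ : (∀ {c d} → step c ≡ just d → width (contents d) ≤ suc (width (contents c))) →
                ∀ i {c d} → run i c ≡ just d → width (contents d) ≤ i + width (contents c)
  run-width-≤ step-≤ zero    refl = ≤-refl
  run-width-≤ step-≤ (suc i) {c} e with run i c in eq
  ... | just _ = ≤-trans (step-≤ e) (s≤s (run-width-≤ step-≤ i eq))

  run-width-≥ : (∀ {c d} → step c ≡ just d → width (contents c) ≤ width (contents d)) →
                ∀ i {c d} → run i c ≡ just d → width (contents c) ≤ width (contents d)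
  run-width-≥ step-≥ zero    refl = ≤-refl
  run-width-≥ step-≥ (suc i) {c} e with run i c in eq
  ... | just _ = ≤-trans (run-width-≥ step-≥ i eq) (step-≥ e)

-- Step-by-step simulation of one machine by another

module Lockstep
  (B A : Machine)
  (Rel : Machine.Configuration B → Machine.Configuration A → Set)
  (cost : Machine.Configuration A → ℕ)
  (simulate : ∀ {a a′} → Machine.step A a ≡ just a′ → ∀ {b} → Rel b a →
              ∃[ τ ] ∃[ b′ ] 0 < τ × τ ≤ cost a × Machine.run B τ b ≡ just b′ × Rel b′ a′)
  (finish : ∀ {a} → Machine.Halted A a → ∀ {b} → Rel b a →
            ∃[ τ ] ∃[ b′ ] τ ≤ cost a × Machine.run B τ b ≡ just b′ × Machine.Halted B b′)
  where

  private
    module A where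
      open Machine A public
      open Run A public
    module B where
      open Machine B public
      open Run B public

  -- The recursion is on the first step of `A`. The outcome of that step is an argument of `times′`,
  -- with its equation, so that the proofs below can match on it without disturbing `simulate`.
  times  : ∀ {b a} → Rel b a → ℕ → ℕ
  times′ : ∀ {b a} → Rel b a → (a? : Maybe A.Configuration) → A.step a ≡ a? → ℕ → ℕ
  times         r zero    = 0
  times {a = a} r (suc i) = times′ r (A.step a) refl i
  -- Once `A` has halted the times no longer mean anything, but they must keep increasing.
  times′ r nothing  e i = suc i
  times′ r (just _) e i = let τ , _ , _ , _ , _ , r′ = simulate e r in τ + times r′ i

  times-increasing  : ∀ {b a} (r : Rel b a) i → times r i < times r (suc i)
  times′-increasing : ∀ {b a} (r : Rel b a) a? e i → times′ r a? e i < times′ r a? e (suc i)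
  times-increasing {a = a} r zero = positive (A.step a) refl
    where
    positive : ∀ a? e → 0 < times′ r a? e 0
    positive nothing  e = s≤s z≤n
    positive (just _) e = let _ , _ , 0<τ , _ = simulate e r in ≤-trans 0<τ (m≤m+n _ _)
  times-increasing {a = a} r (suc i) = times′-increasing r (A.step a) refl i
  times′-increasing r nothing  e i = ≤-refl
  times′-increasing r (just _) e i = let τ , _ , _ , _ , _ , r′ = simulate e r in +-monoʳ-< τ (times-increasing r′ i)

  i≤times : ∀ {b a} (r : Rel b a) i → i ≤ times r i
  i≤times r zero    = z≤n
  i≤times r (suc i) = ≤-trans (s≤s (i≤times r i)) (times-increasing r i)

  times-passes  : ∀ {b a} (r : Rel b a) i {d} → A.run i a ≡ just d → ∃[ b′ ] B.run (times r i) b ≡ just b′ × Rel b′ d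
  times′-passes : ∀ {b a} (r : Rel b a) a? e i {d} → A.run (suc i) a ≡ just d → ∃[ b′ ] B.run (times′ r a? e i) b ≡ just b′ × Rel b′ d
  times-passes {b}     r zero    refl = b , refl , r
  times-passes {a = a} r (suc i) run≡ = times′-passes r (A.step a) refl i run≡
  times′-passes r nothing e i run≡ = contradiction (trans (sym run≡) (A.run-halted i e)) λ ()
  times′-passes r (just _) e i run≡ =
    let τ , _ , _ , _ , run≡′ , r′ = simulate e r
        b″ , run≡″ , r″ = times-passes r′ i (trans (sym (A.run-first i e)) run≡)
    in b″ , trans (B.run-+ τ (times r′ i) run≡′) run≡″ , r″

  times-≤  : ∀ {b a C} (r : Rel b a) i → (∀ j {d} → j ≤ i → A.run j a ≡ just d → cost d ≤ C) →
             ∀ {d} → A.run i a ≡ just d → times r i ≤ i * C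
  times′-≤ : ∀ {b a C} (r : Rel b a) a? e i → (∀ j {d} → j ≤ suc i → A.run j a ≡ just d → cost d ≤ C) →
             ∀ {d} → A.run (suc i) a ≡ just d → times′ r a? e i ≤ suc i * C
  times-≤         r zero    cost≤ run≡ = z≤n
  times-≤ {a = a} r (suc i) cost≤ run≡ = times′-≤ r (A.step a) refl i cost≤ run≡
  times′-≤ r nothing  e i cost≤ run≡ = contradiction (trans (sym run≡) (A.run-halted i e)) λ ()
  times′-≤ r (just _) e i cost≤ run≡ =
    let τ , _ , _ , τ≤ , _ , r′ = simulate e r
    in +-mono-≤ (≤-trans τ≤ (cost≤ 0 z≤n refl))
         (times-≤ r′ i (λ j j≤ run≡′ → cost≤ (suc j) (s≤s j≤) (trans (A.run-first j e) run≡′)) (trans (sym (A.run-first i e)) run≡))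

  module _ {b₀ b a} (r : Rel b a) p (b₀→b : B.run p b₀ ≡ just b) where

    follows : (δ : Decoding B A) → (∀ {b a} → Rel b a → Decodes B A δ b a) → Follows B A δ b₀ a
    follows δ decodes = record
      { s            = λ i → p + times r i
      ; s-increasing = λ i → +-monoʳ-< p (times-increasing r i)
      ; passes       = λ i a run≡ → let b′ , run≡′ , r′ = passes i run≡ in b′ , run≡′ , decodes r′
      ; halts        = mk⇔ to from
      }
      where
      passes : ∀ i {d} → A.run i a ≡ just d → ∃[ b′ ] B.run (p + times r i) b₀ ≡ just b′ × Rel b′ d
      passes i run≡ =
        let b′ , run≡′ , r′ = times-passes r i run≡ in b′ , trans (B.run-+ p (times r i) b₀→b) run≡′ , r′

      to : B.HaltsFrom b₀ → A.HaltsFrom a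
      to (i , d , run≡ , halted) with A.run (suc i) a in eq
      ... | nothing = A.halts-before (suc i) eq
      ... | just e  =
        let b′ , run≡′ , _ = passes (suc i) eq
            -- Were `A` to survive `suc i` steps, `B` would still be running at the corresponding
            -- time, which is no earlier than `suc i`; but `B` has no configuration left at `suc i`.
            later : suc i ≤ p + times r (suc i)
            later = ≤-trans (i≤times r (suc i)) (m≤n+m _ p)
            _ , run≡″ = B.run-earlier (suc i) (p + times r (suc i) ∸ suc i)
                          (subst (λ m → B.run m b₀ ≡ just b′) (sym (m+[n∸m]≡n later)) run≡′)
            stopped : B.run (suc i) b₀ ≡ nothing
            stopped = trans (cong (Maybe._>>= B.step) run≡) halted
        in contradiction (trans (sym run≡″) stopped) λ ()

      from : A.HaltsFrom a → B.HaltsFrom b₀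
      from (i , d , run≡ , halted) =
        let b′ , run≡′ , r′ = passes i run≡
            τ , b″ , _ , run≡″ , halted″ = finish halted r′
        in p + times r i + τ , b″ , trans (B.run-+ (p + times r i) τ run≡′) run≡″ , halted″

    -- The factor `suc i` stands for `i` simulated steps and the concluding run of `finish`.
    runtime : ∀ i {d C} → A.run i a ≡ just d → A.Halted d → (∀ j {e} → j ≤ i → A.run j a ≡ just e → cost e ≤ C) →
              ∃[ τ ] ∃[ b′ ] τ ≤ p + suc i * C × B.run τ b₀ ≡ just b′ × B.Halted b′
    runtime i {d} {C} run≡ halted cost≤ =
      let b′ , run≡′ , r′ = times-passes r i run≡
          τ , b″ , τ≤ , run≡″ , halted″ = finish halted r′
      in p + (times r i + τ) , b″ ,
         +-monoʳ-≤ p (≤-trans (+-mono-≤ (times-≤ r i cost≤ run≡) (≤-trans τ≤ (cost≤ i ≤-refl run≡))) (≤-reflexive (+-comm (i * C) C))) ,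
         trans (B.run-+ p (times r i + τ) b₀→b) (trans (B.run-+ (times r i) τ run≡′) run≡″) , halted″

width-step-WangB : ∀ W {c d} → WangB.step W c ≡ just d → width (contents d) ≤ suc (width (contents c))
width-step-WangB W {config k t} e with view k
width-step-WangB W {config _ t} e | ‵inject₁ j with Vec.lookup (WangB.instructions W) j
width-step-WangB W {config _ t} refl | ‵inject₁ j | L   = width-move-≤ L t
width-step-WangB W {config _ t} refl | ‵inject₁ j | R   = width-move-≤ R t
width-step-WangB W {config _ t} refl | ‵inject₁ j | M   = n≤1+n _
width-step-WangB W {config _ t} refl | ‵inject₁ j | J x = n≤1+n _

-- Narrower windows of the same tape

infix 4 _⊑_

-- The two sides are compared separately because a comparison of total widths is not stable under
-- `move`: a move may extend one window while staying inside the other.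
record _⊑_ (t t′ : Tape) : Set where
  constructor narrower
  field
    same  : t ∼ t′
    left  : length (leftward t) ≤ length (leftward t′)
    right : length (rightward t) ≤ length (rightward t′)

open _⊑_

width-⊑ : ∀ {t t′} → t ⊑ t′ → width t ≤ width t′
width-⊑ t⊑t′ = +-mono-≤ (left t⊑t′) (s≤s (right t⊑t′))

minimise-⊑ : ∀ t → minimise t ⊑ t
minimise-⊑ t = narrower (minimise-∼ t) (length-dropOuterBlanks (leftward t)) (length-dropOuterBlanks (rightward t))

length-leftward-move-L : ∀ t → length (leftward (move L t)) ≡ pred (length (leftward t))
length-leftward-move-L (tape []      _ _) = refl
length-leftward-move-L (tape (_ ∷ _) _ _) = refl

length-rightward-move-L : ∀ t → length (rightward (move L t)) ≡ suc (length (rightward t))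
length-rightward-move-L (tape []      _ _) = refl
length-rightward-move-L (tape (_ ∷ _) _ _) = refl

length-leftward-move-R : ∀ t → length (leftward (move R t)) ≡ suc (length (leftward t))
length-leftward-move-R (tape _ _ [])      = refl
length-leftward-move-R (tape _ _ (_ ∷ _)) = refl

length-rightward-move-R : ∀ t → length (rightward (move R t)) ≡ pred (length (rightward t))
length-rightward-move-R (tape _ _ [])      = refl
length-rightward-move-R (tape _ _ (_ ∷ _)) = refl

move-⊑ : ∀ D {t t′} → t ⊑ t′ → move D t ⊑ move D t′
move-⊑ L {t} {t′} p = narrower (move-∼ L (same p))
  (subst₂ _≤_ (sym (length-leftward-move-L t)) (sym (length-leftward-move-L t′)) (pred-mono-≤ (left p)))
  (subst₂ _≤_ (sym (length-rightward-move-L t)) (sym (length-rightward-move-L t′)) (s≤s (right p)))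
move-⊑ R {t} {t′} p = narrower (move-∼ R (same p))
  (subst₂ _≤_ (sym (length-leftward-move-R t)) (sym (length-leftward-move-R t′)) (s≤s (left p)))
  (subst₂ _≤_ (sym (length-rightward-move-R t)) (sym (length-rightward-move-R t′)) (pred-mono-≤ (right p)))

module _ (𝓜 : TuringMachine) where

  open TuringMachine 𝓜 using (step; f)

  step-⊑ : ∀ {q t t′ d} → t ⊑ t′ → step (config q t′) ≡ just d →
           ∃[ u ] step (config q t) ≡ just (config (control d) u) × u ⊑ contents d
  step-⊑ {q} {t} {t′} p e rewrite same p (ℤ.+ 0) with f q (Tape.head t′)
  step-⊑ {q} {t} {t′} p refl | just (x , D , _) =
    _ , refl , move-⊑ D (narrower (write-∼ x (same p)) (left p) (right p))

  halted-⊑ : ∀ {q t t′} → t ⊑ t′ → step (config q t′) ≡ nothing → step (config q t) ≡ nothing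
  halted-⊑ {q} {t} {t′} p e rewrite same p (ℤ.+ 0) with f q (Tape.head t′)
  ... | nothing = refl

-- The factor is the value of the left side at `t = 1`. For `t = 1 + u` the difference of the two
-- sides is a polynomial in `u` with nonnegative coefficients.
cubic : ∀ U k t → 0 < t →
        (1 + suc t * (suc t * (U * (2 * t + 3)))) + (1 + suc t * k) ≤ (20 * U + 2 * k + 2) * t ^ 3
cubic U k (suc u) _ = subst (lhs ≤_)
  (solve 3 (λ U k u →
    (con 1 :+ (con 2 :+ u) :* ((con 2 :+ u) :* (U :* (con 2 :* (con 1 :+ u) :+ con 3)))) :+ (con 1 :+ (con 2 :+ u) :* k)
      :+ (U :* (con 18 :* u :* u :* u :+ con 47 :* u :* u :+ con 32 :* u)
          :+ k :* (con 2 :* u :* u :* u :+ con 6 :* u :* u :+ con 5 :* u)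
          :+ (con 2 :* u :* u :* u :+ con 6 :* u :* u :+ con 6 :* u))
    := (con 20 :* U :+ con 2 :* k :+ con 2) :* ((con 1 :+ u) :* ((con 1 :+ u) :* ((con 1 :+ u) :* con 1)))) refl U k u)
  (m≤m+n lhs _)
  where
  lhs = (1 + suc (suc u) * (suc (suc u) * (U * (2 * suc u + 3)))) + (1 + suc (suc u) * k)

module Simulation
  (𝓜 : TuringMachine) (B : Machine)
  (width-step : ∀ {b b′} → Machine.step B b ≡ just b′ → width (contents b′) ≤ suc (width (contents b)))
  (Encodes : Machine.Configuration B → Config (suc (TuringMachine.last 𝓜)) → Set)
  (unit : ℕ)
  (encodes-step : ∀ {a a′} → TuringMachine.step 𝓜 a ≡ just a′ → ∀ {b} → Encodes b a →
                  ∃[ τ ] ∃[ b′ ] 0 < τ × τ ≤ passTime unit (width (contents a)) × Machine.run B τ b ≡ just b′ × Encodes b′ a′)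
  (encodes-halted : ∀ {a} → Machine.Halted (turing 𝓜) a → ∀ {b} → Encodes b a →
                    ∃[ τ ] ∃[ b′ ] τ ≤ passTime unit (width (contents a)) × Machine.run B τ b ≡ just b′ × Machine.Halted B b′)
  (ε : Encoding B (turing 𝓜)) (initial : Config (suc (TuringMachine.last 𝓜)) → Machine.Configuration B)
  (encode : ∀ a → Transducer.transduce ε (word a) ≡ just (word (initial a)))
  (initial-start : ∀ a → Machine.Initial B (initial a))
  (entered : ∀ a → ∃[ b ] Machine.run B 1 (initial a) ≡ just b × Encodes b a)
  (blockWidth : ℕ) (width-initial : ∀ a → width (contents (initial a)) ≤ 1 + suc (width (contents a)) * blockWidth)
  (δ : Decoding B (turing 𝓜)) (decode : ∀ {b a} → Encodes b a → δ ⟨ b ⟩↦ a)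
  where

  A : Machine
  A = turing 𝓜

  open Machine A using () renaming (run to runᴬ; Halted to Haltedᴬ; Configuration to Configurationᴬ)
  open Machine B using (run; Halted; RunsInTime; Configuration)

  Rel : Configuration → Configurationᴬ → Set
  Rel b a = ∃[ t ] Encodes b (config (control a) t) × t ⊑ contents a

  cost : Configurationᴬ → ℕ
  cost a = passTime unit (width (contents a))

  passTime-mono : ∀ {v w} → v ≤ w → passTime unit v ≤ passTime unit w
  passTime-mono v≤w = *-mono-≤ (s≤s v≤w) (*-monoʳ-≤ unit (+-monoˡ-≤ 3 (*-monoʳ-≤ 2 v≤w)))

  simulate : ∀ {a a′} → Machine.step A a ≡ just a′ → ∀ {b} → Rel b a →
             ∃[ τ ] ∃[ b′ ] 0 < τ × τ ≤ cost a × run τ b ≡ just b′ × Rel b′ a′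
  simulate e (t , enc , t⊑) =
    let u , e′ , u⊑ = step-⊑ 𝓜 t⊑ e
        τ , b′ , 0<τ , τ≤ , run≡ , enc′ = encodes-step e′ enc
    in τ , b′ , 0<τ , ≤-trans τ≤ (passTime-mono (width-⊑ t⊑)) , run≡ , u , enc′ , u⊑

  finish : ∀ {a} → Haltedᴬ a → ∀ {b} → Rel b a → ∃[ τ ] ∃[ b′ ] τ ≤ cost a × run τ b ≡ just b′ × Halted b′
  finish e (t , enc , t⊑) =
    let τ , b′ , τ≤ , run≡ , halted = encodes-halted (halted-⊑ 𝓜 t⊑ e) enc
    in τ , b′ , ≤-trans τ≤ (passTime-mono (width-⊑ t⊑)) , run≡ , halted

  decodes : ∀ {b a} → Rel b a → Decodes B A δ b a
  decodes {a = a} (t , enc , t⊑) = config (control a) t , decode enc , refl , same t⊑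

  open Lockstep B A Rel cost simulate finish

  minimal : Configurationᴬ → Configurationᴬ
  minimal a = config (control a) (minimise (contents a))

  module _ {a₀ b₁} (r : Rel b₁ a₀) (run₁ : run 1 (initial (minimal a₀)) ≡ just b₁) where

    runsInTime : ∀ t → Machine.RunsInTime A a₀ t → RunsInTime (initial (minimal a₀)) ((20 * unit + 2 * blockWidth + 2) * t ^ 3)
    runsInTime t (i , d , i≤t , run≡ , halted , d≤t) =
      let τ , b′ , τ≤ , run≡′ , halted′ = runtime r 1 run₁ i run≡ halted cost≤
          τ≤′ = ≤-trans τ≤ (s≤s (*-monoˡ-≤ (passTime unit t) (s≤s i≤t)))
      in τ , b′ , ≤-trans τ≤′ (≤-trans (m≤m+n _ _) total) , run≡′ , halted′ ,
         -- The final width is at most the number of steps plus the initial width, and `total`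
         -- bounds this sum, hence time and space at once.
         ≤-trans (RunWidth.run-width-≤ B width-step τ run≡′) (≤-trans (+-mono-≤ τ≤′ width-initial-≤) total)
      where
      open Run A
      total : (1 + suc t * passTime unit t) + (1 + suc t * blockWidth) ≤ (20 * unit + 2 * blockWidth + 2) * t ^ 3
      -- Every window contains the head cell, so a bound `t` on the width is positive.
      total = cubic unit blockWidth t (≤-trans (≤-trans (s≤s z≤n) (m≤n+m (suc (length (rightward (contents d)))) (length (leftward (contents d))))) d≤t)
      width-≤t : ∀ j {e} → j ≤ i → runᴬ j a₀ ≡ just e → width (contents e) ≤ t
      width-≤t j {e} j≤i run≡ⱼ = ≤-trans
        (RunWidth.run-width-≥ A (width-step-≥ 𝓜) (i ∸ j)
          (trans (sym (run-+ j (i ∸ j) run≡ⱼ)) (trans (cong (λ m → runᴬ m a₀) (m+[n∸m]≡n j≤i)) run≡))) d≤t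
      cost≤ : ∀ j {e} → j ≤ i → runᴬ j a₀ ≡ just e → cost e ≤ passTime unit t
      cost≤ j j≤i run≡ⱼ = passTime-mono (width-≤t j j≤i run≡ⱼ)
      width-initial-≤ : width (contents (initial (minimal a₀))) ≤ 1 + suc t * blockWidth
      width-initial-≤ = ≤-trans (width-initial (minimal a₀))
        (s≤s (*-monoˡ-≤ blockWidth (s≤s (≤-trans (width-minimise (contents a₀)) (width-≤t 0 z≤n refl)))))

  simulates : SimulatesInTimeO B A (λ t → t ^ 3)
  simulates = record
    { ε       = ε
    ; δ       = δ
    ; factor  = 20 * unit + 2 * blockWidth + 2
    ; encodes = λ a₀ _ →
        let b , run₁ , enc = entered (minimal a₀)
            r = minimise (contents a₀) , enc , minimise-⊑ (contents a₀)
        in initial (minimal a₀) , encode (minimal a₀) , initial-start (minimal a₀) ,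
           follows r 1 run₁ δ decodes , runsInTime r run₁
    }

module Start (𝓜 : TuringMachine) where
  open Pass 𝓜

  initial : Config n → Config (suc end)
  initial a = config zero ⟨ [] ∣ true ∷ blocks (queue a) ⟩

  entered : ∀ a → ∃[ b ] Machine.run (wangB machine) 1 (initial a) ≡ just b × Encodes b a
  entered a =
    -- The encoding puts a 1 under the head, so the opening jump to the start state is taken; it
    -- accounts for the one step before the simulation begins.
    let k , T , run≡ , k≡ , T∼ = follow (reach-jump {p = 0} (located refl) (located-< (located-entry (carry nothing))) refl) {zero} refl ∼-refl
    in config k T , run≡ , k≡ , [] , T∼

  length-blocks : ∀ xs → length (blocks xs) ≡ length xs * (2 + K)
  length-blocks []       = refl
  length-blocks (x ∷ xs) = begin
    length (body x ++ true ∷ blocks xs)         ≡⟨ length-++ (body x) ⟩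
    length (body x) + suc (length (blocks xs))  ≡⟨ cong₂ (λ m n → suc m + suc n) (length-code x) (length-blocks xs) ⟩
    suc K + suc (length xs * (2 + K))           ≡⟨ +-suc (suc K) _ ⟩
    2 + K + length xs * (2 + K)                 ∎
    where open ≡-Reasoning

  width-initial : ∀ a → width (contents (initial a)) ≤ 1 + suc (width (contents a)) * (2 + K)
  width-initial a = s≤s (≤-reflexive (trans (length-blocks (queue a)) (cong (_* (2 + K)) (length-queue a))))

theorem1 : (M : TuringMachine) → ∃[ W ] SimulatesInTimeO (wangB W) (turing M) (λ t → t ^ 3)
theorem1 𝓜 = machine ,
  Simulation.simulates 𝓜 (wangB machine) (width-step-WangB machine) Encodes unit
    encodes-step encodes-halted
    encoding initial (λ a → transduce-encoding (word a)) (λ _ → refl) entered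
    (2 + K) width-initial decoding (λ {b} {a} (_ , ls , T∼) → decode {b} {ls} {a} T∼)
  where
  open Pass 𝓜
  open Coding 𝓜
  open Start 𝓜
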